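{- For every integer $l\ge 2$, $$(1+o(1))\,(2l+1)\,\frac{m^{l}}{(2l+1)^{l}} \le \rho(P_{2l},m) \le \frac{m^{l}}{2(l-1)^{l-1}},$$ where the upper bound holds for every positive integer $m$, and in the lower bound $o(1)$ denotes a quantity tending to $0$ as $m\to\infty$ with $l$ fixed.
   Context: Graphs are finite, simple and undirected. $P_k$ denotes the path on $k$ vertices. For graphs $G$ and $H$, $c(G,H)$ is the number of induced copies of $H$ in $G$, i.e. the number of subsets $S\subseteq V(G)$ such that the induced subgraph $G[S]$ is isomorphic to $H$. For a positive integer $m$, $\rho(H,m)=\max\{c(G,H) : G \text{ a graph with } |E(G)|=m\}$ (the number of vertices of $G$ is not restricted). -}

module Defs where

open import Data.Bool using (Bool; true; false; _∨_)
open import Data.Bool.Properties using (∨-comm)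
import Data.Bool.Properties as Bool
open import Data.Fin using (Fin; toℕ; finToFun; funToFin)
import Data.Fin as Fin
open import Data.Fin.Properties using (all?; any?; finToFun-funToFin)
import Data.Fin.Properties as Fin
open import Data.Fin.Subset using (Subset; inside; outside; _∈_)
open import Data.Fin.Subset.Properties using (_∈?_)
open import Data.Integer using (+_)
open import Data.List using (List; []; _∷_; _++_; map; length; filter; allFin; cartesianProduct)
open import Data.Nat using (ℕ; zero; suc; _+_; _*_; _∸_; _^_; _≤_; NonZero; >-nonZero)
import Data.Nat as ℕ
import Data.Nat.Properties as ℕ
open import Data.Product using (Σ; ∃; ∃-syntax; Σ-syntax; _×_; _,_; proj₁; proj₂)
open import Data.Rational.Unnormalised using (ℚᵘ; 0ℚᵘ; _/_; ∣_∣)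
import Data.Rational.Unnormalised as ℚ
open import Data.Vec using ([]; _∷_)
open import Data.Vec.Properties.WithK using ([]=-irrelevant)
open import Function using (_↔_; Inverse; mk↔ₛ′)
open import Relation.Binary.PropositionalEquality using (_≡_; refl; sym; trans; cong; cong₂; subst)
open import Relation.Nullary using (Dec; does; map′; _×-dec_; _→-dec_)
open import Relation.Nullary.Decidable using (dec-false)

record Graph (V : Set) : Set where
  field
    adj       : V → V → Bool
    adj-sym   : ∀ x y → adj x y ≡ adj y x
    adj-irref : ∀ x → adj x x ≡ false

open Graph public

-- A finite graph is, up to isomorphism, a graph on Fin n; the number of its
-- edges is the number of adjacent pairs i < j.
edgeCount : ∀ {n} → Graph (Fin n) → ℕ
edgeCount {n} G =
  length (filter (λ (i , j) → (i Fin.<? j) ×-dec (adj G i j Bool.≟ true))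
                 (cartesianProduct (allFin n) (allFin n)))

path : ∀ k → Graph (Fin k)
path k = record
  { adj       = λ i j → next i j ∨ next j i
  ; adj-sym   = λ i j → ∨-comm (next i j) (next j i)
  ; adj-irref = irref
  }
  where
  next : Fin k → Fin k → Bool
  next i j = does (suc (toℕ i) ℕ.≟ toℕ j)

  irref : ∀ i → next i i ∨ next i i ≡ false
  irref i = cong (λ b → b ∨ b) (dec-false (suc (toℕ i) ℕ.≟ toℕ i) ℕ.1+n≢n)

_[_] : ∀ {n} → Graph (Fin n) → (S : Subset n) → Graph (∃ (_∈ S))
G [ S ] = record
  { adj       = λ x y → adj G (proj₁ x) (proj₁ y)
  ; adj-sym   = λ x y → adj-sym G (proj₁ x) (proj₁ y)
  ; adj-irref = λ x → adj-irref G (proj₁ x)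
  }

infix 4 _≅_
_≅_ : ∀ {V W} → Graph V → Graph W → Set
_≅_ {V} {W} G H =
  Σ[ φ ∈ V ↔ W ] (∀ x y → adj G x y ≡ adj H (Inverse.to φ x) (Inverse.to φ y))

-- Decidability of G[S] ≅ H by exhaustive search for the inverse isomorphism,
-- seen as a map from V(H) to V(G) with image S.
module _ {n k} (G : Graph (Fin n)) (S : Subset n) (H : Graph (Fin k)) where

  IsEmbedding : (Fin k → Fin n) → Set
  IsEmbedding f = (∀ i → f i ∈ S)
                × (∀ v → v ∈ S → ∃[ i ] f i ≡ v)
                × (∀ i j → f i ≡ f j → i ≡ j)
                × (∀ i j → adj G (f i) (f j) ≡ adj H i j)

  isEmbedding? : ∀ f → Dec (IsEmbedding f)
  isEmbedding? f =
          all? (λ i → f i ∈? S)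
    ×-dec all? (λ v → (v ∈? S) →-dec any? (λ i → f i Fin.≟ v))
    ×-dec all? (λ i → all? (λ j → (f i Fin.≟ f j) →-dec (i Fin.≟ j)))
    ×-dec all? (λ i → all? (λ j → adj G (f i) (f j) Bool.≟ adj H i j))

  IsEmbedding-resp : ∀ {f g} → (∀ i → g i ≡ f i) → IsEmbedding f → IsEmbedding g
  IsEmbedding-resp g≗f (into , onto , inj , hom) =
      (λ i → subst (_∈ S) (sym (g≗f i)) (into i))
    , (λ v v∈S → let (i , eq) = onto v v∈S in i , trans (g≗f i) eq)
    , (λ i j eq → inj i j (trans (sym (g≗f i)) (trans eq (g≗f j))))
    , (λ i j → trans (cong₂ (adj G) (g≗f i) (g≗f j)) (hom i j))

  Σ≡ : {x y : ∃ (_∈ S)} → proj₁ x ≡ proj₁ y → x ≡ y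
  Σ≡ {x , p} {.x , q} refl = cong (x ,_) ([]=-irrelevant p q)

  embedding⇒iso : ∀ {f} → IsEmbedding f → G [ S ] ≅ H
  embedding⇒iso {f} (into , onto , inj , hom) =
    mk↔ₛ′ to (λ i → f i , into i)
      (λ i → inj _ _ (f∘to (f i , into i)))
      (λ x → Σ≡ (f∘to x))
    , λ x y → trans (cong₂ (adj G) (sym (f∘to x)) (sym (f∘to y))) (hom (to x) (to y))
    where
    to : ∃ (_∈ S) → Fin k
    to (v , v∈S) = proj₁ (onto v v∈S)

    f∘to : ∀ x → f (to x) ≡ proj₁ x
    f∘to (v , v∈S) = proj₂ (onto v v∈S)

  iso⇒embedding : G [ S ] ≅ H → ∃ IsEmbedding
  iso⇒embedding (φ , hom) =
      (λ i → proj₁ (from i))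
    , (λ i → proj₂ (from i))
    , (λ v v∈S → to (v , v∈S) , cong proj₁ (strictlyInverseʳ (v , v∈S)))
    , (λ i j eq → trans (sym (strictlyInverseˡ i))
                        (trans (cong to (Σ≡ eq)) (strictlyInverseˡ j)))
    , (λ i j → trans (hom (from i) (from j))
                     (cong₂ (adj H) (strictlyInverseˡ i) (strictlyInverseˡ j)))
    where open Inverse φ

  induces? : Dec (G [ S ] ≅ H)
  induces? = map′
    (λ (c , e) → embedding⇒iso e)
    (λ iso → let (f , e) = iso⇒embedding iso in
             funToFin f , IsEmbedding-resp (finToFun-funToFin f) e)
    (any? {n = n ^ k} (λ c → isEmbedding? (finToFun c)))

allSubsets : ∀ n → List (Subset n)
allSubsets zero    = [] ∷ []
allSubsets (suc n) = map (inside ∷_) (allSubsets n) ++ map (outside ∷_) (allSubsets n)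

inducedCopies : ∀ {n k} → Graph (Fin n) → Graph (Fin k) → ℕ
inducedCopies {n} G H = length (filter (λ S → induces? G S H) (allSubsets n))

-- r = max { c(G,H) : |E(G)| = m }, the maximum ranging over graphs of every
-- order.  This is a relation in r because for some H (those with isolated
-- vertices) the maximum need not exist.
record Isρ {k} (H : Graph (Fin k)) (m r : ℕ) : Set where
  field
    attained   : ∃[ n ] Σ[ G ∈ Graph (Fin n) ] (edgeCount G ≡ m × inducedCopies G H ≡ r)
    upperBound : ∀ n (G : Graph (Fin n)) → edgeCount G ≡ m → inducedCopies G H ≤ r

fromℕ : ℕ → ℚᵘ
fromℕ a = + a / 1

TendsToZero : (ℕ → ℚᵘ) → Set
TendsToZero δ = ∀ ε → 0ℚᵘ ℚ.< ε → ∃[ M ] (∀ m → M ≤ m → ∣ δ m ∣ ℚ.< ε)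

lowerMain : (l m : ℕ) → ℚᵘ
lowerMain l m = fromℕ (2 * l + 1) ℚ.* _/_ (+ (m ^ l)) ((2 * l + 1) ^ l) {{nz}}
  where
  nz : NonZero ((2 * l + 1) ^ l)
  nz = ℕ.m^n≢0 (2 * l + 1) l {{>-nonZero (ℕ.m≤n+m 1 (2 * l))}}

upperMain : (l : ℕ) → 2 ≤ l → (m : ℕ) → ℚᵘ
upperMain l 2≤l m = _/_ (+ (m ^ l)) (2 * (l ∸ 1) ^ (l ∸ 1)) {{nz}}
  where
  nz : NonZero (2 * (l ∸ 1) ^ (l ∸ 1))
  nz = ℕ.m*n≢0 2 _ {{_}} {{ℕ.m^n≢0 (l ∸ 1) (l ∸ 1) {{>-nonZero (ℕ.∸-monoˡ-≤ 1 2≤l)}}}}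

{-# OPTIONS --safe #-}

-- Upper bound.  An induced path v₁ … v₂ₗ is recovered from its edges v₁v₂, v₃v₄, …, and each
-- copy arises from two directions.  After an edge {v₁, v₂} has been chosen in m ways, the
-- candidates for v₃v₄, v₅v₆, … lie in pairwise disjoint sets of edges: a candidate for
-- v₂ᵢ₊₁v₂ᵢ₊₂ has an end adjacent to v₂ᵢ, while both ends of all later candidates are not.  The
-- l − 1 sets have at most m edges altogether (over both directions of the first edge), so by
-- AM–GM there are at most (m / (l − 1))^(l − 1) continuations.
--
-- Lower bound.  Replace every vertex of the cycle C₂ₗ₊₁ by s independent vertices, with s the
-- largest number such that (2l + 1) s² ≤ m, and add disjoint edges.  Any choice of one vertex
-- from each of 2l of the classes induces a P₂ₗ.
--
-- The maximum exists because isolated vertices can be discarded, which leaves graphs with at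
-- most 2m vertices.

module Submission where

open import Defs
open import Data.Nat using (ℕ; _≤_; _*_)
open import Data.Product using (Σ-syntax; ∃-syntax; _×_)
open import Data.Rational.Unnormalised using (ℚᵘ; 1ℚᵘ) renaming (_+_ to _+ᵘ_; _*_ to _*ᵘ_; _≤_ to _≤ᵘ_)
open import Data.Bool using (Bool; true; false; not; _∧_; _∨_)
import Data.Bool.Properties as Bool
open import Data.Fin using (Fin; zero; suc; toℕ; inject₁; punchIn; punchOut; opposite;
  combine; remQuot; finToFun; funToFin)
import Data.Fin as Fin
open import Data.Fin.Induction using (>-weakInduction)
open import Data.Fin.Properties using (any?; all?)
import Data.Fin.Properties as Fin
open import Data.Fin.Relation.Unary.Top using (view; ‵fromℕ; ‵inject₁)
open import Data.Fin.Subset using (Subset; inside; outside) renaming (_∈_ to _∈ₛ_)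
import Data.Fin.Subset.Properties as Subset
import Data.Integer as ℤ
import Data.Integer.Properties as ℤ
import Data.Integer.Tactic.RingSolver as ℤ-Solver
open import Data.List using (List; []; _∷_; _++_; map; length; filter; filterᵇ; lookup; tabulate; allFin;
  cartesianProduct; concatMap; upTo)
open import Data.List.Extrema.Nat using (argmax; argmax-all; f[xs]≤f[argmax])
open import Data.List.Membership.Propositional using (_∈_; lose)
open import Data.List.Membership.Propositional.Properties
open import Data.List.Properties using (length-++; length-map; length-tabulate; ∷-injective)
open import Data.List.Relation.Unary.All as All using (All; []; _∷_)
import Data.List.Relation.Unary.All.Properties as All
open import Data.List.Relation.Unary.AllPairs using ([]; _∷_)
open import Data.List.Relation.Unary.Any using (here; there; index)
open import Data.List.Relation.Unary.Any.Properties using (lookup-index)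
open import Data.List.Relation.Unary.Unique.Propositional using (Unique)
import Data.List.Relation.Unary.Unique.Propositional.Properties as Unique
open import Data.Nat using (zero; suc; _+_; _∸_; _^_; _<_; z≤n; s≤s; NonZero; >-nonZero)
open import Data.Nat.Properties
open import Data.Nat.Tactic.RingSolver using (solve-∀)
open import Data.Product using (∃; _,_; proj₁; proj₂; swap)
open import Data.Rational.Unnormalised using (mkℚᵘ; *≤*; *<*; _/_)
open import Data.Sum using (_⊎_; inj₁; inj₂)
open import Data.Unit using (⊤; tt)
open import Data.Vec using ([]; _∷_)
import Data.Vec as Vec
import Data.Vec.Properties as Vec
open import Function using (_∘_; case_of_)
open import Function.Bundles using (Equivalence; mk⇔)
open import Relation.Binary.Definitions using (tri<; tri≈; tri>)
open import Relation.Binary.PropositionalEquality hiding ([_])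
open import Relation.Nullary using (¬_; Dec; yes; no; does; contradiction; _×-dec_)
open import Relation.Nullary.Decidable using (dec-true; dec-false; does-⇔)

private variable
  A B : Set

-- Double counting

lookup-injective : {xs : List A} → Unique xs → ∀ i j → lookup xs i ≡ lookup xs j → i ≡ j
lookup-injective (_ ∷ _)  zero    zero    _  = refl
lookup-injective (x∉ ∷ _) zero    (suc j) eq = contradiction eq (All.lookup x∉ (∈-lookup j))
lookup-injective (x∉ ∷ _) (suc i) zero    eq = contradiction (sym eq) (All.lookup x∉ (∈-lookup i))
lookup-injective (_ ∷ xs!) (suc i) (suc j) eq = cong suc (lookup-injective xs! i j eq)

-- The chosen partners define a map between the index sets, and it is injective because a partner
-- determines its entry. Using a relation lets the partner be built from the membership proof.
length-≤-by-relation : {xs : List A} {ys : List B} (R : A → B → Set) → Unique xs →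
  (∀ {x} → x ∈ xs → ∃[ y ] y ∈ ys × R x y) →
  (∀ {x x′ y} → R x y → R x′ y → x ≡ x′) →
  length xs ≤ length ys
length-≤-by-relation {xs = xs} {ys} R xs! total unique = Fin.injective⇒≤ {f = f} f-injective
  where
  partner : ∀ i → ∃[ y ] y ∈ ys × R (lookup xs i) y
  partner i = total (∈-lookup i)

  f : Fin (length xs) → Fin (length ys)
  f i = index (proj₁ (proj₂ (partner i)))

  f-injective : ∀ {i j} → f i ≡ f j → i ≡ j
  f-injective {i} {j} eq with partner i | partner j
  ... | y , y∈ , r | y′ , y′∈ , r′ = lookup-injective xs! i j (unique r (subst (R _) y′≡y r′))
    where y′≡y = trans (lookup-index y′∈) (trans (cong (lookup ys) (sym eq)) (sym (lookup-index y∈)))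

length-mono-⊆ : {xs ys : List A} → Unique xs → (∀ {x} → x ∈ xs → x ∈ ys) → length xs ≤ length ys
length-mono-⊆ xs! xs⊆ys = length-≤-by-relation _≡_ xs! (λ x∈ → _ , xs⊆ys x∈ , refl) (λ p q → trans p (sym q))

length-cartesianProduct : (xs : List A) (ys : List B) →
  length (cartesianProduct xs ys) ≡ length xs * length ys
length-cartesianProduct []       ys = refl
length-cartesianProduct (x ∷ xs) ys = begin
  length (map (x ,_) ys ++ cartesianProduct xs ys)            ≡⟨ length-++ (map (x ,_) ys) ⟩
  length (map (x ,_) ys) + length (cartesianProduct xs ys)    ≡⟨ cong₂ _+_ (length-map _ ys) (length-cartesianProduct xs ys) ⟩
  length ys + length xs * length ys                           ∎
  where open ≡-Reasoning

length-allFin : ∀ n → length (allFin n) ≡ n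
length-allFin n = length-tabulate {n = n} (λ i → i)

∈-concatMap-intro : ∀ (f : A → List B) {xs x y} → x ∈ xs → y ∈ f x → y ∈ concatMap f xs
∈-concatMap-intro f x∈ y∈ = ∈-concatMap⁺ f (lose x∈ y∈)

-- The factor `c` is a denominator kept on the left: for `c = t ^ t` the bounds of the form (M /
-- t)^t stay in ℕ.
length-concatMap-≤ : ∀ (f : A → List B) (c d : ℕ) xs →
  (∀ {x} → x ∈ xs → length (f x) * c ≤ d) → length (concatMap f xs) * c ≤ length xs * d
length-concatMap-≤ f c d []       bound = z≤n
length-concatMap-≤ f c d (x ∷ xs) bound = begin
  length (f x ++ concatMap f xs) * c            ≡⟨ cong (_* c) (length-++ (f x)) ⟩
  (length (f x) + length (concatMap f xs)) * c  ≡⟨ *-distribʳ-+ c (length (f x)) _ ⟩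
  length (f x) * c + length (concatMap f xs) * c
    ≤⟨ +-mono-≤ (bound (here refl)) (length-concatMap-≤ f c d xs (bound ∘ there)) ⟩
  d + length xs * d                             ∎
  where open ≤-Reasoning

-- Weighted AM–GM

2xy≤x²+y² : ∀ x y → 2 * (x * y) ≤ x * x + y * y
2xy≤x²+y² x y with ≤-total x y
... | inj₁ x≤y with d , refl ← m≤n⇒∃[o]m+o≡n x≤y = m+n≤o⇒m≤o _ (≤-reflexive (identity x d))
  where
  identity : ∀ x d → 2 * (x * (x + d)) + d * d ≡ x * x + (x + d) * (x + d)
  identity = solve-∀
... | inj₂ y≤x with d , refl ← m≤n⇒∃[o]m+o≡n y≤x = m+n≤o⇒m≤o _ (≤-reflexive (identity y d))
  where
  identity : ∀ y d → 2 * ((y + d) * y) + d * d ≡ (y + d) * (y + d) + y * y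
  identity = solve-∀

^-distribʳ-* : ∀ o m n → (m * n) ^ o ≡ m ^ o * n ^ o
^-distribʳ-* zero    m n = refl
^-distribʳ-* (suc o) m n =
  trans (cong (m * n *_) (^-distribʳ-* o m n)) (identity m n (m ^ o) (n ^ o))
  where
  identity : ∀ m n p q → m * n * (p * q) ≡ m * p * (n * q)
  identity = solve-∀

-- AM-GM for `x` and `s` copies of `y`, stated through powers. Induction on `s`: add `x` times the
-- previous case, apply 2xy ≤ x² + y², and cancel the added term.
pow-amgm : ∀ s x y → suc s * (x * y ^ s) ≤ x ^ suc s + s * y ^ suc s
pow-amgm zero    x y = ≤-reflexive (identity x)
  where
  identity : ∀ x → 1 * (x * 1) ≡ x * 1 + 0
  identity = solve-∀
pow-amgm (suc s) x y = +-cancelʳ-≤ (x * (suc s * (x * p))) _ _ (begin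
  suc (suc s) * (x * (y * p)) + x * (suc s * (x * p))
    ≤⟨ +-monoʳ-≤ (suc (suc s) * (x * (y * p))) (*-monoʳ-≤ x (pow-amgm s x y)) ⟩
  suc (suc s) * (x * (y * p)) + x * (q + s * (y * p))
    ≡⟨ identity₁ s x y p q ⟩
  x * q + suc s * (2 * (x * y)) * p
    ≤⟨ +-monoʳ-≤ (x * q) (*-monoˡ-≤ p (*-monoʳ-≤ (suc s) (2xy≤x²+y² x y))) ⟩
  x * q + suc s * (x * x + y * y) * p
    ≡⟨ identity₂ s x y p q ⟩
  x * q + suc s * (y * (y * p)) + x * (suc s * (x * p)) ∎)
  where
  open ≤-Reasoning
  p = y ^ s
  q = x ^ suc s

  identity₁ : ∀ s x y p q →
    suc (suc s) * (x * (y * p)) + x * (q + s * (y * p)) ≡ x * q + suc s * (2 * (x * y)) * p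
  identity₁ = solve-∀

  identity₂ : ∀ s x y p q →
    x * q + suc s * (x * x + y * y) * p ≡ x * q + suc s * (y * (y * p)) + x * (suc s * (x * p))
  identity₂ = solve-∀

-- For fixed a + b the product a b^s is largest at b = s a. Accordingly `pow-amgm` is applied to s
-- (a + b) and (s + 1) b, which coincide there. The case s = 0 is separate because a factor `s` gets
-- cancelled.
weighted-amgm : ∀ s a b → suc s ^ suc s * (a * b ^ s) ≤ s ^ s * (a + b) ^ suc s
weighted-amgm zero a b = m+n≤o⇒m≤o _ (≤-reflexive (identity a b))
  where
  identity : ∀ a b → 1 * (a * 1) + b ≡ 1 * ((a + b) * 1)
  identity = solve-∀
weighted-amgm s@(suc _) a b = *-cancelˡ-≤ s (+-cancelʳ-≤ (s * (suc s * b * t)) _ _ (begin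
  s * (suc s * suc s ^ s * (a * b ^ s)) + s * (suc s * b * t)
    ≡⟨ cong (λ z → s * (suc s * suc s ^ s * (a * b ^ s)) + s * (suc s * b * z)) (^-distribʳ-* s (suc s) b) ⟩
  s * (suc s * suc s ^ s * (a * b ^ s)) + s * (suc s * b * (suc s ^ s * b ^ s))
    ≡⟨ identity₁ s a b (suc s ^ s) (b ^ s) ⟩
  suc s * (s * (a + b) * (suc s ^ s * b ^ s))
    ≡⟨ cong (λ z → suc s * (s * (a + b) * z)) (^-distribʳ-* s (suc s) b) ⟨
  suc s * (s * (a + b) * t)
    ≤⟨ pow-amgm s (s * (a + b)) (suc s * b) ⟩
  (s * (a + b)) ^ suc s + s * (suc s * b * t)
    ≡⟨ cong (_+ s * (suc s * b * t)) (trans (^-distribʳ-* (suc s) s (a + b)) (*-assoc s (s ^ s) _)) ⟩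
  s * (s ^ s * (a + b) ^ suc s) + s * (suc s * b * t) ∎))
  where
  open ≤-Reasoning
  t = (suc s * b) ^ s

  identity₁ : ∀ s a b p q →
    s * (suc s * p * (a * q)) + s * (suc s * b * (p * q)) ≡ suc s * (s * (a + b) * (p * q))
  identity₁ = solve-∀

-- One level of the count: `n` choices of the next edge, each with at most (c / s)^s completions,
-- where the choices and the remaining supply `c` share `M` edges. The result has the same shape
-- with s + 1.
amgm-step : ∀ s {N n c M} → N * s ^ s ≤ n * c ^ s → n + c ≤ M → N * suc s ^ suc s ≤ M ^ suc s
amgm-step s {N} {n} {c} {M} N≤ n+c≤M = *-cancelˡ-≤ (s ^ s) {{sˢ≢0 s}} (begin
  s ^ s * (N * suc s ^ suc s)   ≡⟨ identity (s ^ s) N (suc s ^ suc s) ⟩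
  suc s ^ suc s * (N * s ^ s)   ≤⟨ *-monoʳ-≤ (suc s ^ suc s) N≤ ⟩
  suc s ^ suc s * (n * c ^ s)   ≤⟨ weighted-amgm s n c ⟩
  s ^ s * (n + c) ^ suc s       ≤⟨ *-monoʳ-≤ (s ^ s) (^-monoˡ-≤ (suc s) n+c≤M) ⟩
  s ^ s * M ^ suc s             ∎)
  where
  open ≤-Reasoning

  sˢ≢0 : ∀ s → NonZero (s ^ s)
  -- Here 0 ^ 0 = 1.
  sˢ≢0 zero    = _
  sˢ≢0 (suc s) = m^n≢0 (suc s) (suc s)

  identity : ∀ a b c → a * (b * c) ≡ c * (b * a)
  identity = solve-∀

-- Finite sums

ι : Bool → ℕ
ι true  = 1
ι false = 0

∑ : List A → (A → ℕ) → ℕ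
∑ []       f = 0
∑ (x ∷ xs) f = f x + ∑ xs f

∑-distrib-+ : ∀ (xs : List A) f g → ∑ xs f + ∑ xs g ≡ ∑ xs (λ x → f x + g x)
∑-distrib-+ []       f g = refl
∑-distrib-+ (x ∷ xs) f g =
  trans (identity (f x) (∑ xs f) (g x) (∑ xs g)) (cong (f x + g x +_) (∑-distrib-+ xs f g))
  where
  identity : ∀ a b c d → (a + b) + (c + d) ≡ (a + c) + (b + d)
  identity = solve-∀

∑-mono : ∀ (xs : List A) {f g} → (∀ x → f x ≤ g x) → ∑ xs f ≤ ∑ xs g
∑-mono []       f≤g = z≤n
∑-mono (x ∷ xs) f≤g = +-mono-≤ (f≤g x) (∑-mono xs f≤g)

∑-const-1 : (xs : List A) → ∑ xs (λ _ → 1) ≡ length xs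
∑-const-1 []       = refl
∑-const-1 (x ∷ xs) = cong suc (∑-const-1 xs)

∑-map : ∀ (f : A → B) g xs → ∑ (map f xs) g ≡ ∑ xs (g ∘ f)
∑-map f g []       = refl
∑-map f g (x ∷ xs) = cong (g (f x) +_) (∑-map f g xs)

∑-++ : ∀ xs ys (f : A → ℕ) → ∑ (xs ++ ys) f ≡ ∑ xs f + ∑ ys f
∑-++ []       ys f = refl
∑-++ (x ∷ xs) ys f = trans (cong (f x +_) (∑-++ xs ys f)) (sym (+-assoc (f x) _ _))

length-filterᵇ : ∀ p (xs : List A) → length (filterᵇ p xs) ≡ ∑ xs (ι ∘ p)
length-filterᵇ p []       = refl
length-filterᵇ p (x ∷ xs) with p x
... | true  = cong suc (length-filterᵇ p xs)
... | false = length-filterᵇ p xs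

ι≤1 : ∀ b → ι b ≤ 1
ι≤1 true  = ≤-refl
ι≤1 false = z≤n

ι-mono : ∀ {b c} → (b ≡ true → c ≡ true) → ι b ≤ ι c
ι-mono {false} f = z≤n
ι-mono {true}  f rewrite f refl = ≤-refl

∧-intro : ∀ {b c} → b ≡ true → c ≡ true → b ∧ c ≡ true
∧-intro refl refl = refl

∧-elim : ∀ {b c} → b ∧ c ≡ true → b ≡ true × c ≡ true
∧-elim {true} {true} refl = refl , refl

-- Edges and walks

module _ {n} (G : Graph (Fin n)) where

  isEdge? : (e : Fin n × Fin n) → Dec (proj₁ e Fin.< proj₂ e × adj G (proj₁ e) (proj₂ e) ≡ true)
  isEdge? (i , j) = (i Fin.<? j) ×-dec (adj G i j Bool.≟ true)

  -- Has the same form as the list in `edgeCount`, so that `length edges` is `edgeCount G` by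
  -- computation.
  edges : List (Fin n × Fin n)
  edges = filter isEdge? (cartesianProduct (allFin n) (allFin n))

  darts : List (Fin n × Fin n)
  darts = edges ++ map swap edges

  edges-unique : Unique edges
  edges-unique = Unique.filter⁺ isEdge? (Unique.cartesianProduct⁺ (Unique.allFin⁺ n) (Unique.allFin⁺ n))

  ∈-edges⁺ : ∀ {i j} → i Fin.< j → adj G i j ≡ true → (i , j) ∈ edges
  ∈-edges⁺ i<j ij = ∈-filter⁺ isEdge? (∈-cartesianProduct⁺ (∈-allFin _) (∈-allFin _)) (i<j , ij)

  ∈-edges⁻ : ∀ {e} → e ∈ edges → proj₁ e Fin.< proj₂ e × adj G (proj₁ e) (proj₂ e) ≡ true
  ∈-edges⁻ e∈ = proj₂ (∈-filter⁻ isEdge? {xs = cartesianProduct (allFin n) (allFin n)} e∈)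

  adj⇒≢ : ∀ {x y} → adj G x y ≡ true → x ≢ y
  adj⇒≢ {x} xy refl = case trans (sym xy) (adj-irref G x) of λ ()

  ∈-darts⁺ : ∀ {x y} → adj G x y ≡ true → (x , y) ∈ darts
  ∈-darts⁺ {x} {y} xy with Fin.<-cmp x y
  ... | tri< x<y _ _  = ∈-++⁺ˡ (∈-edges⁺ x<y xy)
  ... | tri≈ _ x≡y _  = contradiction x≡y (adj⇒≢ xy)
  ... | tri> _ _ y<x  = ∈-++⁺ʳ edges (∈-map⁺ swap (∈-edges⁺ y<x (trans (adj-sym G y x) xy)))

  -- walks t P u lists the vertex sequences x₁ y₁ … x_t y_t of alternating
  -- edges of an induced path whose last vertex so far is u; P marks the
  -- vertices with no neighbour among the earlier vertices of the path.

  away : (Fin n → Bool) → Fin n → (Fin n → Bool)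
  away P u z = P z ∧ not (adj G u z)

  continues : (Fin n → Bool) → Fin n → Fin n × Fin n → Bool
  continues P u (x , y) = (P x ∧ P y) ∧ (adj G u x ∧ not (adj G u y))

  continuations : (Fin n → Bool) → Fin n → List (Fin n × Fin n)
  continuations P u = filterᵇ (continues P u) darts

  walks : ℕ → (Fin n → Bool) → Fin n → List (List (Fin n))
  walks zero    P u = [] ∷ []
  walks (suc t) P u =
    concatMap (λ (x , y) → map (λ r → x ∷ y ∷ r) (walks t (away (away P u) x) y))
              (continuations P u)

  inner : (Fin n → Bool) → Fin n × Fin n → ℕ
  inner P (x , y) = ι (P x ∧ P y)

  -- Edges with both ends in `P`. All later alternate edges of a walk are among them, so this is the
  -- supply that the remaining steps share.
  capacity : (Fin n → Bool) → ℕ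
  capacity P = ∑ edges (inner P)

  capacity-mono : ∀ {P Q} → (∀ z → P z ≡ true → Q z ≡ true) → capacity P ≤ capacity Q
  capacity-mono {P} P⊆Q = ∑-mono edges λ (x , y) →
    ι-mono λ pxy → let (px , py) = ∧-elim {P x} pxy in ∧-intro (P⊆Q x px) (P⊆Q y py)

  length-continuations : ∀ P u → length (continuations P u) ≡
    ∑ edges (λ e → ι (continues P u e) + ι (continues P u (swap e)))
  length-continuations P u = begin
    length (filterᵇ c darts)                          ≡⟨ length-filterᵇ c darts ⟩
    ∑ darts (ι ∘ c)                                   ≡⟨ ∑-++ edges _ (ι ∘ c) ⟩
    ∑ edges (ι ∘ c) + ∑ (map swap edges) (ι ∘ c)      ≡⟨ cong (∑ edges (ι ∘ c) +_) (∑-map swap (ι ∘ c) edges) ⟩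
    ∑ edges (ι ∘ c) + ∑ edges (ι ∘ c ∘ swap)          ≡⟨ ∑-distrib-+ edges (ι ∘ c) (ι ∘ c ∘ swap) ⟩
    ∑ edges (λ e → ι (c e) + ι (c (swap e)))          ∎
    where
    open ≡-Reasoning
    c = continues P u

  -- An edge inside P either lies away from u or continues the path at u in at
  -- most one direction.
  continuations+capacity : ∀ P u → length (continuations P u) + capacity (away P u) ≤ capacity P
  continuations+capacity P u = begin
    length (continuations P u) + capacity (away P u)
      ≡⟨ cong (_+ capacity (away P u)) (length-continuations P u) ⟩
    ∑ edges f + ∑ edges (inner (away P u))
      ≡⟨ ∑-distrib-+ edges f (inner (away P u)) ⟩
    ∑ edges (λ e → f e + inner (away P u) e)
      ≤⟨ ∑-mono edges (λ (x , y) → pointwise (P x) (P y) (adj G u x) (adj G u y)) ⟩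
    capacity P ∎
    where
    open ≤-Reasoning

    f : Fin n × Fin n → ℕ
    f e = ι (continues P u e) + ι (continues P u (swap e))

    pointwise : ∀ p q a b →
      ι ((p ∧ q) ∧ (a ∧ not b)) + ι ((q ∧ p) ∧ (b ∧ not a)) + ι ((p ∧ not a) ∧ (q ∧ not b)) ≤ ι (p ∧ q)
    pointwise false false a     b     = z≤n
    pointwise false true  a     b     = z≤n
    pointwise true  false true  b     = z≤n
    pointwise true  false false b     = z≤n
    pointwise true  true  true  true  = z≤n
    pointwise true  true  true  false = s≤s z≤n
    pointwise true  true  false true  = s≤s z≤n
    pointwise true  true  false false = s≤s z≤n

  -- Mutual induction with `walks-step`. The choices for the next edge and the edges left for later
  -- steps are disjoint parts of the supply, and AM-GM bounds the product of their sizes.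
  walks-bound : ∀ t P u → length (walks t P u) * t ^ t ≤ capacity P ^ t

  -- After the edge (x , y) the walk stays in `away (away P u) x`, a part of `away P u`. Passing to
  -- the larger set gives one bound `c` for all choices of (x , y).
  walks-step : ∀ t P u {c} → capacity (away P u) ≤ c →
    length (walks (suc t) P u) * t ^ t ≤ length (continuations P u) * c ^ t
  walks-step t P u {c} cap≤c =
    length-concatMap-≤ _ (t ^ t) (c ^ t) (continuations P u) λ { {x , y} _ → begin
      length (map (λ r → x ∷ y ∷ r) (walks t (away (away P u) x) y)) * t ^ t
        ≡⟨ cong (_* t ^ t) (length-map _ (walks t (away (away P u) x) y)) ⟩
      length (walks t (away (away P u) x) y) * t ^ t
        ≤⟨ walks-bound t (away (away P u) x) y ⟩
      capacity (away (away P u) x) ^ t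
        ≤⟨ ^-monoˡ-≤ t (≤-trans (capacity-mono {away (away P u) x} {away P u} (λ _ → proj₁ ∘ ∧-elim)) cap≤c) ⟩
      c ^ t ∎ }
    where open ≤-Reasoning

  walks-bound zero    P u = ≤-refl
  walks-bound (suc t) P u =
    amgm-step t {N = length (walks (suc t) P u)} {n = length (continuations P u)}
              (walks-step t P u ≤-refl) (continuations+capacity P u)

  -- Walks from a first edge in both directions

  free : Fin n → (Fin n → Bool)
  free a z = not (adj G a z)

  walksFrom : ℕ → Fin n × Fin n → List (List (Fin n))
  walksFrom t (a , b) = map (λ r → a ∷ b ∷ r) (walks t (free a) b)

  allWalks : ℕ → List (List (Fin n))
  allWalks t = concatMap (λ e → walksFrom t e ++ walksFrom t (swap e)) edges

  capacity-free-swap : ∀ a b → capacity (away (free b) a) ≤ capacity (away (free a) b)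
  capacity-free-swap a b = capacity-mono {away (free b) a} {away (free a) b} λ z →
    trans (Bool.∧-comm (free a z) (free b z))

  -- This saves a factor 2: the two directions of the first edge draw on the same supply of edges.
  -- An edge that avoids the neighbours of `a` and also those of `b` is counted twice in the sum of
  -- the two capacities, and this excess is the term `c` that gets cancelled.
  both-directions : ∀ a b →
    length (continuations (free a) b) + length (continuations (free b) a) + capacity (away (free a) b)
      ≤ edgeCount G
  both-directions a b = +-cancelʳ-≤ c _ _ (begin
    nᵃ + nᵇ + c + c
      ≡⟨ identity nᵃ nᵇ c ⟩
    (nᵃ + c) + (nᵇ + c)
      ≤⟨ +-mono-≤ (continuations+capacity (free a) b)
                  (≤-trans (+-monoʳ-≤ nᵇ (capacity-free-swap b a)) (continuations+capacity (free b) a)) ⟩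
    capacity (free a) + capacity (free b)
      ≡⟨ ∑-distrib-+ edges _ _ ⟩
    ∑ edges (λ e → inner (free a) e + inner (free b) e)
      ≤⟨ ∑-mono edges (λ (x , y) → pointwise (free a x) (free a y) (free b x) (free b y)) ⟩
    ∑ edges (λ e → 1 + inner (away (free a) b) e)
      ≡⟨ ∑-distrib-+ edges (λ _ → 1) (inner (away (free a) b)) ⟨
    ∑ edges (λ _ → 1) + c
      ≡⟨ cong (_+ c) (∑-const-1 edges) ⟩
    edgeCount G + c ∎)
    where
    open ≤-Reasoning
    c  = capacity (away (free a) b)
    nᵃ = length (continuations (free a) b)
    nᵇ = length (continuations (free b) a)

    identity : ∀ a b c → a + b + c + c ≡ (a + c) + (b + c)
    identity = solve-∀

    pointwise : ∀ p q r s → ι (p ∧ q) + ι (r ∧ s) ≤ 1 + ι ((p ∧ r) ∧ (q ∧ s))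
    pointwise false q     r     s = ι≤1 (r ∧ s)
    pointwise true  false false s = z≤n
    pointwise true  false true  s = ≤-trans (ι≤1 s) (m≤m+n 1 _)
    pointwise true  true  false s = s≤s z≤n
    pointwise true  true  true  s = ≤-refl

  -- The first edge is chosen freely. For the second alternate edge the choices from both directions
  -- are added up before `amgm-step` is applied, which is possible because both directions leave the
  -- same capacity.
  allWalks-bound : ∀ s → length (allWalks (suc s)) * suc s ^ suc s ≤ edgeCount G ^ suc (suc s)
  allWalks-bound s = length-concatMap-≤ _ (t ^ t) _ edges λ { {a , b} _ → begin
      length (walksFrom t (a , b) ++ walksFrom t (b , a)) * t ^ t
        ≡⟨ cong (_* t ^ t) (trans (length-++ (walksFrom t (a , b)))
                                  (cong₂ _+_ (length-map _ (walks t (free a) b)) (length-map _ (walks t (free b) a)))) ⟩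
      (length (walks t (free a) b) + length (walks t (free b) a)) * t ^ t
        ≤⟨ amgm-step s
             {N = length (walks t (free a) b) + length (walks t (free b) a)}
             {n = length (continuations (free a) b) + length (continuations (free b) a)}
             (joint a b) (both-directions a b) ⟩
      edgeCount G ^ t ∎ }
    where
    open ≤-Reasoning
    t = suc s

    joint : ∀ a b →
      (length (walks t (free a) b) + length (walks t (free b) a)) * s ^ s ≤
      (length (continuations (free a) b) + length (continuations (free b) a)) * capacity (away (free a) b) ^ s
    joint a b = begin
      (length (walks t (free a) b) + length (walks t (free b) a)) * s ^ s
        ≡⟨ *-distribʳ-+ (s ^ s) (length (walks t (free a) b)) _ ⟩
      length (walks t (free a) b) * s ^ s + length (walks t (free b) a) * s ^ s
        ≤⟨ +-mono-≤ (walks-step s (free a) b ≤-refl) (walks-step s (free b) a (capacity-free-swap a b)) ⟩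
      length (continuations (free a) b) * c ^ s + length (continuations (free b) a) * c ^ s
        ≡⟨ *-distribʳ-+ (c ^ s) (length (continuations (free a) b)) _ ⟨
      (length (continuations (free a) b) + length (continuations (free b) a)) * c ^ s ∎
      where c = capacity (away (free a) b)

-- Induced paths as walks

tabulate-injective : ∀ {n} {f g : Fin n → A} → tabulate f ≡ tabulate g → ∀ i → f i ≡ g i
tabulate-injective eq zero    = proj₁ (∷-injective eq)
tabulate-injective eq (suc i) = tabulate-injective (proj₂ (∷-injective eq)) i

module _ {n} (G : Graph (Fin n)) where

  OnlyHeadAdjacent : Fin n → List (Fin n) → Set
  OnlyHeadAdjacent x []       = ⊤
  OnlyHeadAdjacent x (y ∷ ys) = adj G x y ≡ true × All (λ z → adj G x z ≡ false) ys

  IsPath : List (Fin n) → Set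
  IsPath []       = ⊤
  IsPath (x ∷ xs) = OnlyHeadAdjacent x xs × IsPath xs

  -- The walk takes two vertices at a time, and the length is written `t * 2` so that it computes to
  -- two successors at each step. The non-adjacencies of `u` and `x` to the tail are what extends
  -- `P` to `away (away P u) x`.
  ∈-walks : ∀ t P u {r} → length r ≡ t * 2 → All (λ z → P z ≡ true) r → IsPath (u ∷ r) →
            r ∈ walks G t P u
  ∈-walks zero    P u {[]}        _   _                _ = here refl
  ∈-walks (suc t) P u {x ∷ y ∷ r} len (px ∷ py ∷ pr) ((ux , uy ∷ ur) , (xy , xr) , yr) =
    ∈-concatMap-intro _
      (∈-filter⁺ (Bool.T? ∘ continues G P u) (∈-darts⁺ G xy)
        (Equivalence.from Bool.T-≡ (∧-intro (∧-intro px py) (∧-intro ux (cong not uy)))))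
      (∈-map⁺ _ (∈-walks t (away G (away G P u) x) y (suc-injective (suc-injective len))
        (All.zipWith (λ (p , xz) → ∧-intro p (cong not xz))
          (All.zipWith (λ (p , uz) → ∧-intro p (cong not uz)) (pr , ur) , xr))
        yr))

  ∈-walksFrom : ∀ t a b {r} → length r ≡ t * 2 → IsPath (a ∷ b ∷ r) →
                a ∷ b ∷ r ∈ walksFrom G t (a , b)
  ∈-walksFrom t a b len ((_ , ar) , br) =
    ∈-map⁺ _ (∈-walks t (free G a) b len (All.map (cong not) ar) br)

  -- The first two vertices form an edge in increasing or in decreasing order, which selects one of
  -- the two summands for that edge.
  ∈-allWalks : ∀ t {r} → length r ≡ suc t * 2 → IsPath r → r ∈ allWalks G t
  ∈-allWalks t {a ∷ b ∷ r} len ab@((adj-ab , _) , _) with ∈-++⁻ (edges G) (∈-darts⁺ G adj-ab)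
  ... | inj₁ ab∈ = ∈-concatMap-intro _ ab∈
                     (∈-++⁺ˡ (∈-walksFrom t a b (suc-injective (suc-injective len)) ab))
  ... | inj₂ ab∈ with _ , ba∈ , refl ← ∈-map⁻ swap ab∈ =
    ∈-concatMap-intro _ ba∈
      (∈-++⁺ʳ (walksFrom G t (b , a)) (∈-walksFrom t a b (suc-injective (suc-injective len)) ab))

  IsPath-tabulate : ∀ {k} (f : Fin k → Fin n) →
    (∀ i j → adj G (f i) (f j) ≡ adj (path k) i j) → IsPath (tabulate f)
  IsPath-tabulate {zero}        f hom = tt
  IsPath-tabulate {suc zero}    f hom = tt , tt
  IsPath-tabulate {suc (suc k)} f hom =
      (hom zero (suc zero) , All.tabulate⁺ (λ i → hom zero (suc (suc i))))
    , IsPath-tabulate (f ∘ suc) (λ i j → hom (suc i) (suc j))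

-- Since i + 1 + `opposite i` = k, reversal turns each successor step into a predecessor step, which
-- swaps the two disjuncts of adjacency.
path-opposite : ∀ {k} (i j : Fin k) → adj (path k) (opposite i) (opposite j) ≡ adj (path k) i j
path-opposite {k} i j = trans (cong₂ _∨_ (next-opposite i j) (next-opposite j i)) (Bool.∨-comm (next j i) (next i j))
  where
  next : Fin k → Fin k → Bool
  next i j = does (suc (toℕ i) ≟ toℕ j)

  successor : ∀ i j → suc (toℕ (opposite i)) ≡ toℕ (opposite j) → suc (toℕ j) ≡ toℕ {k} i
  successor i j eq = +-cancelʳ-≡ (toℕ (opposite j)) _ _ (begin
    suc (toℕ j) + toℕ (opposite j)  ≡⟨ total j ⟩
    k                               ≡⟨ total i ⟨
    suc (toℕ i) + toℕ (opposite i)  ≡⟨ +-suc (toℕ i) _ ⟨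
    toℕ i + suc (toℕ (opposite i))  ≡⟨ cong (toℕ i +_) eq ⟩
    toℕ i + toℕ (opposite j)        ∎)
    where
    open ≡-Reasoning
    total : ∀ i → suc (toℕ i) + toℕ (opposite i) ≡ k
    total i = trans (cong (suc (toℕ i) +_) (Fin.opposite-prop i)) (m+[n∸m]≡n (Fin.toℕ<n i))

  next-opposite : ∀ i j → next (opposite i) (opposite j) ≡ next j i
  next-opposite i j = does-⇔ (mk⇔ (successor i j) back) (suc (toℕ (opposite i)) ≟ toℕ (opposite j)) (suc (toℕ j) ≟ toℕ i)
    where
    -- The converse is the same implication for the reversed indices, because `opposite` is an
    -- involution.
    back : suc (toℕ j) ≡ toℕ i → suc (toℕ (opposite i)) ≡ toℕ (opposite j)
    back eq = successor (opposite j) (opposite i)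
      (subst₂ (λ a b → suc (toℕ a) ≡ toℕ b) (sym (Fin.opposite-involutive j)) (sym (Fin.opposite-involutive i)) eq)

-- Induced copies

∈-allSubsets : ∀ {n} (S : Subset n) → S ∈ allSubsets n
∈-allSubsets []            = here refl
∈-allSubsets (inside  ∷ S) = ∈-++⁺ˡ (∈-map⁺ _ (∈-allSubsets S))
∈-allSubsets (outside ∷ S) = ∈-++⁺ʳ (map (inside ∷_) (allSubsets _)) (∈-map⁺ _ (∈-allSubsets S))

allSubsets-unique : ∀ n → Unique (allSubsets n)
allSubsets-unique zero    = [] ∷ []
allSubsets-unique (suc n) = Unique.++⁺
  (Unique.map⁺ Vec.∷-injectiveʳ (allSubsets-unique n))
  (Unique.map⁺ Vec.∷-injectiveʳ (allSubsets-unique n))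
  λ (p , q) → case ∈-map⁻ _ p , ∈-map⁻ _ q of λ { ((_ , _ , refl) , (_ , _ , ())) }

module _ {n k} (G : Graph (Fin n)) (H : Graph (Fin k)) where

  copies : List (Subset n)
  copies = filter (λ S → induces? G S H) (allSubsets n)

  copies-unique : Unique copies
  copies-unique = Unique.filter⁺ (λ S → induces? G S H) (allSubsets-unique n)

  ∈-copies⁺ : ∀ {S f} → IsEmbedding G S H f → S ∈ copies
  ∈-copies⁺ {S} emb = ∈-filter⁺ (λ S → induces? G S H) (∈-allSubsets S) (embedding⇒iso G S H emb)

  ∈-copies⁻ : ∀ {S} → S ∈ copies → ∃ (IsEmbedding G S H)
  ∈-copies⁻ {S} S∈ = iso⇒embedding G S H (proj₂ (∈-filter⁻ (λ S → induces? G S H) {xs = allSubsets n} S∈))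

  embedding-image-⊆ : ∀ {S S′ f g} → IsEmbedding G S H f → IsEmbedding G S′ H g →
    (∀ i → f i ≡ g i) → ∀ {v} → v ∈ₛ S → v ∈ₛ S′
  embedding-image-⊆ {S′ = S′} (_ , onto , _) (into , _) f≗g v∈S =
    let (i , fi≡v) = onto _ v∈S in subst (_∈ₛ S′) (trans (sym (f≗g i)) fi≡v) (into i)

  -- The clauses `into` and `onto` make the set the image of the map, so a copy can be recovered
  -- from the vertex sequence of a traversal.
  embedding-image-unique : ∀ {S S′ f g} → IsEmbedding G S H f → IsEmbedding G S′ H g →
    (∀ i → f i ≡ g i) → S ≡ S′
  embedding-image-unique e e′ f≗g = Subset.⊆-antisym
    (embedding-image-⊆ e e′ f≗g) (embedding-image-⊆ e′ e (sym ∘ f≗g))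

-- Upper bound for the number of copies

embedding-opposite : ∀ {n k} (G : Graph (Fin n)) {S f} →
  IsEmbedding G S (path k) f → IsEmbedding G S (path k) (f ∘ opposite)
embedding-opposite G {f = f} (into , onto , inj , hom) =
    into ∘ opposite
  , (λ v v∈S → let (i , eq) = onto v v∈S in opposite i , trans (cong f (Fin.opposite-involutive i)) eq)
  , (λ i j eq → trans (sym (Fin.opposite-involutive i))
                      (trans (cong opposite (inj _ _ eq)) (Fin.opposite-involutive j)))
  , (λ i j → trans (hom _ _) (path-opposite i j))

<?-flip : ∀ {n} {i j : Fin n} → i ≢ j → not (does (i Fin.<? j)) ≡ does (j Fin.<? i)
<?-flip {i = i} {j} i≢j with Fin.<-cmp i j
... | tri< lt _ ¬gt = trans (cong not (dec-true (i Fin.<? j) lt)) (sym (dec-false (j Fin.<? i) ¬gt))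
... | tri≈ _ eq _   = contradiction eq i≢j
... | tri> ¬lt _ gt = trans (cong not (dec-false (i Fin.<? j) ¬lt)) (sym (dec-true (j Fin.<? i) gt))

-- Every copy is traversed in two directions, distinguished by the order of the
-- two end vertices.
twice-copies≤allWalks : ∀ {n} (G : Graph (Fin n)) s →
  2 * inducedCopies G (path (2 * suc (suc s))) ≤ length (allWalks G (suc s))
twice-copies≤allWalks {n} G s = begin
  2 * length cs                                       ≡⟨ length-cartesianProduct (true ∷ false ∷ []) cs ⟨
  length (cartesianProduct (true ∷ false ∷ []) cs)    ≤⟨ length-≤-by-relation Traverses
                                                          (Unique.cartesianProduct⁺ (((λ ()) ∷ []) ∷ [] ∷ []) (copies-unique G H))
                                                          total unique ⟩
  length (allWalks G (suc s))                         ∎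
  where
  open ≤-Reasoning
  N = 2 * suc (suc s)
  H = path N
  cs = copies G H

  last : Fin N
  last = opposite zero

  Traverses : Bool × Subset n → List (Fin n) → Set
  Traverses (b , S) r = ∃[ f ] IsEmbedding G S H f × r ≡ tabulate f × b ≡ does (f zero Fin.<? f last)

  traversal : ∀ {b S f} → IsEmbedding G S H f → b ≡ does (f zero Fin.<? f last) →
    ∃[ r ] r ∈ allWalks G (suc s) × Traverses (b , S) r
  traversal {f = f} e b≡ =
      tabulate f
    , ∈-allWalks G (suc s) (trans (length-tabulate f) (*-comm 2 (suc (suc s))))
        (IsPath-tabulate G f (proj₂ (proj₂ (proj₂ e))))
    , f , e , refl , b≡

  ends-distinct : ∀ {S f} → IsEmbedding G S H f → f zero ≢ f last
  ends-distinct (_ , _ , inj , _) eq = case inj zero last eq of λ ()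

  either-direction : ∀ {b S f} → IsEmbedding G S H f → Dec (b ≡ does (f zero Fin.<? f last)) →
    ∃[ r ] r ∈ allWalks G (suc s) × Traverses (b , S) r
  either-direction e (yes b≡) = traversal e b≡
  -- Reversal exchanges the two ends; as these are distinct, their comparison is negated and now
  -- agrees with `b`.
  either-direction {f = f} e (no b≢) = traversal (embedding-opposite G e)
    (trans (Bool.¬-not b≢) (trans (<?-flip (ends-distinct e))
      (cong (λ i → does (f last Fin.<? f i)) (sym (Fin.opposite-involutive zero)))))

  total : ∀ {x} → x ∈ cartesianProduct (true ∷ false ∷ []) cs → ∃[ r ] r ∈ allWalks G (suc s) × Traverses x r
  total {b , S} x∈ =
    let (f , e) = ∈-copies⁻ G H (proj₂ (∈-cartesianProduct⁻ (true ∷ false ∷ []) cs x∈))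
    in either-direction e (b Bool.≟ does (f zero Fin.<? f last))

  unique : ∀ {x x′ r} → Traverses x r → Traverses x′ r → x ≡ x′
  unique (f , e , refl , b≡) (g , e′ , eq , b′≡) = cong₂ _,_
    (trans b≡ (trans (cong₂ (λ u v → does (u Fin.<? v)) (f≗g zero) (f≗g last)) (sym b′≡)))
    (embedding-image-unique G H e e′ f≗g)
    where f≗g = tabulate-injective eq

copies-bound : ∀ {n} (G : Graph (Fin n)) {l} → 2 ≤ l →
  inducedCopies G (path (2 * l)) * (2 * (l ∸ 1) ^ (l ∸ 1)) ≤ edgeCount G ^ l
copies-bound G {suc (suc s)} (s≤s (s≤s z≤n)) = begin
  c * (2 * suc s ^ suc s)                        ≡⟨ identity c (suc s ^ suc s) ⟩
  2 * c * suc s ^ suc s                          ≤⟨ *-monoˡ-≤ (suc s ^ suc s) (twice-copies≤allWalks G s) ⟩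
  length (allWalks G (suc s)) * suc s ^ suc s    ≤⟨ allWalks-bound G s ⟩
  edgeCount G ^ suc (suc s)                      ∎
  where
  open ≤-Reasoning
  c = inducedCopies G (path (2 * suc (suc s)))

  identity : ∀ c p → c * (2 * p) ≡ 2 * c * p
  identity = solve-∀

-- Transfer between graphs

module _ {n n′} (G : Graph (Fin n)) (G′ : Graph (Fin n′)) (_~_ : Fin n → Fin n′ → Set)
  (~-unique : ∀ {v w v′} → v ~ v′ → w ~ v′ → v ≡ w)
  (~-adj : ∀ {v w v′ w′} → v ~ v′ → w ~ w′ → adj G v w ≡ adj G′ v′ w′)
  where

  -- Partners are required only for vertices on an edge, so isolated vertices may be dropped. The
  -- partner of an increasing pair may be decreasing, hence the two alternatives in `_~ₑ_`.
  edgeCount-transfer : (∀ {v w} → adj G v w ≡ true → ∃[ v′ ] v ~ v′) → edgeCount G ≤ edgeCount G′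
  edgeCount-transfer total = length-≤-by-relation _~ₑ_ (edges-unique G) partner ~ₑ-unique
    where
    _~ₑ_ : Fin n × Fin n → Fin n′ × Fin n′ → Set
    (v , w) ~ₑ (v′ , w′) = v Fin.< w × ((v ~ v′ × w ~ w′) ⊎ (v ~ w′ × w ~ v′))

    partner : ∀ {e} → e ∈ edges G → ∃[ e′ ] e′ ∈ edges G′ × e ~ₑ e′
    partner {v , w} e∈
      with v<w , vw ← ∈-edges⁻ G e∈
      with v′ , v~v′ ← total vw
      with w′ , w~w′ ← total (trans (adj-sym G w v) vw)
      with ∈-++⁻ (edges G′) (∈-darts⁺ G′ (trans (sym (~-adj v~v′ w~w′)) vw))
    ... | inj₁ e′∈ = (v′ , w′) , e′∈ , v<w , inj₁ (v~v′ , w~w′)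
    ... | inj₂ e′∈ with (w′ , v′) , e″∈ , refl ← ∈-map⁻ swap e′∈ =
      (w′ , v′) , e″∈ , v<w , inj₂ (v~v′ , w~w′)

    ~ₑ-unique : ∀ {e f e′} → e ~ₑ e′ → f ~ₑ e′ → e ≡ f
    ~ₑ-unique (_   , inj₁ (p , q)) (_   , inj₁ (r , s)) = cong₂ _,_ (~-unique p r) (~-unique q s)
    ~ₑ-unique (_   , inj₂ (p , q)) (_   , inj₂ (r , s)) = cong₂ _,_ (~-unique p r) (~-unique q s)
    -- With opposite orientations the two edges would be the reverses of each other, yet both are
    -- increasing.
    ~ₑ-unique (v<w , inj₁ (p , q)) (x<y , inj₂ (r , s))
      with refl ← ~-unique p s | refl ← ~-unique q r = contradiction x<y (<-asym v<w)
    ~ₑ-unique (v<w , inj₂ (p , q)) (x<y , inj₁ (r , s))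
      with refl ← ~-unique p s | refl ← ~-unique q r = contradiction x<y (<-asym v<w)

image : ∀ {n k} → (Fin k → Fin n) → Subset n
image f = Vec.tabulate (λ v → does (any? (λ i → f i Fin.≟ v)))

∈-image⁺ : ∀ {n k} (f : Fin k → Fin n) i → f i ∈ₛ image f
∈-image⁺ f i = Vec.lookup⇒[]= (f i) _
  (trans (Vec.lookup∘tabulate _ (f i)) (dec-true (any? (λ j → f j Fin.≟ f i)) (i , refl)))

∈-image⁻ : ∀ {n k} (f : Fin k → Fin n) {v} → v ∈ₛ image f → ∃[ i ] f i ≡ v
∈-image⁻ f {v} v∈ with any? (λ i → f i Fin.≟ v)
                     | trans (sym (Vec.lookup∘tabulate (λ v → does (any? (λ i → f i Fin.≟ v))) v)) (Vec.[]=⇒lookup v∈)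
... | yes p | _  = p
... | no  _ | ()

module _ {n k} (G : Graph (Fin n)) (H : Graph (Fin k)) where

  image-embedding : ∀ {f} → (∀ i j → f i ≡ f j → i ≡ j) → (∀ i j → adj G (f i) (f j) ≡ adj H i j) →
    IsEmbedding G (image f) H f
  image-embedding {f} inj hom = ∈-image⁺ f , (λ _ → ∈-image⁻ f) , inj , hom

module _ {n n′ k} (G : Graph (Fin n)) (G′ : Graph (Fin n′)) (H : Graph (Fin k))
  (_~_ : Fin n → Fin n′ → Set)
  (~-unique : ∀ {v w v′} → v ~ v′ → w ~ v′ → v ≡ w)
  (~-adj : ∀ {v w v′ w′} → v ~ v′ → w ~ w′ → adj G v w ≡ adj G′ v′ w′)
  where

  -- Partners are required only for vertices of a copy. The relation `_~ₛ_` covers both sets, so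
  -- uniqueness of partners lets `S` be recovered from `S′`.
  copies-transfer :
    (∀ {f : Fin k → Fin n} → (∀ i j → adj G (f i) (f j) ≡ adj H i j) → ∀ i → ∃[ v′ ] f i ~ v′) →
    inducedCopies G H ≤ inducedCopies G′ H
  copies-transfer total = length-≤-by-relation _~ₛ_ (copies-unique G H) partner ~ₛ-unique
    where
    _~ₛ_ : Subset n → Subset n′ → Set
    S ~ₛ S′ = (∀ {v} → v ∈ₛ S → ∃[ v′ ] v′ ∈ₛ S′ × v ~ v′)
            × (∀ {v′} → v′ ∈ₛ S′ → ∃[ v ] v ∈ₛ S × v ~ v′)

    embedded-partner : ∀ {S} → ∃ (IsEmbedding G S H) → ∃[ S′ ] S′ ∈ copies G′ H × S ~ₛ S′
    embedded-partner (f , into , onto , inj , hom) =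
        image f′
      , ∈-copies⁺ G′ H (image-embedding G′ H
          (λ i j eq → inj i j (~-unique (f~f′ i) (subst (f j ~_) (sym eq) (f~f′ j))))
          (λ i j → trans (sym (~-adj (f~f′ i) (f~f′ j))) (hom i j)))
      , (λ v∈S → let (i , fi≡v) = onto _ v∈S in f′ i , ∈-image⁺ f′ i , subst (_~ f′ i) fi≡v (f~f′ i))
      , (λ v′∈S′ → let (i , f′i≡v′) = ∈-image⁻ f′ v′∈S′ in f i , into i , subst (f i ~_) f′i≡v′ (f~f′ i))
      where
      f′ : Fin k → Fin n′
      f′ i = proj₁ (total hom i)
      f~f′ : ∀ i → f i ~ f′ i
      f~f′ i = proj₂ (total hom i)

    partner : ∀ {S} → S ∈ copies G H → ∃[ S′ ] S′ ∈ copies G′ H × S ~ₛ S′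
    partner S∈ = embedded-partner (∈-copies⁻ G H S∈)

    ~ₛ-⊆ : ∀ {S T S′} → S ~ₛ S′ → T ~ₛ S′ → ∀ {v} → v ∈ₛ S → v ∈ₛ T
    ~ₛ-⊆ {T = T} (into , _) (_ , back) v∈S =
      let (v′ , v′∈ , v~v′) = into v∈S
          (w , w∈ , w~v′)   = back v′∈
      in subst (_∈ₛ T) (~-unique w~v′ v~v′) w∈

    ~ₛ-unique : ∀ {S T S′} → S ~ₛ S′ → T ~ₛ S′ → S ≡ T
    ~ₛ-unique p q = Subset.⊆-antisym (~ₛ-⊆ p q) (~ₛ-⊆ q p)

-- Existence of the maximum

restrict : ∀ {n k} → Graph (Fin n) → (Fin k → Fin n) → Graph (Fin k)
restrict G h = record
  { adj       = λ x y → adj G (h x) (h y)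
  ; adj-sym   = λ x y → adj-sym G (h x) (h y)
  ; adj-irref = λ x → adj-irref G (h x)
  }

NoIsolated : ∀ {k} → Graph (Fin k) → Set
NoIsolated H = ∀ i → ∃[ j ] adj H i j ≡ true

path-NoIsolated : ∀ {k} → 2 ≤ k → NoIsolated (path k)
path-NoIsolated (s≤s (s≤s z≤n)) zero    = suc zero , refl
path-NoIsolated (s≤s (s≤s z≤n)) (suc i) = inject₁ i , trans
  (cong (before ∨_) (dec-true (suc (toℕ (inject₁ i)) ≟ suc (toℕ i)) (cong suc (Fin.toℕ-inject₁ i))))
  (Bool.∨-zeroʳ before)
  where
  before : Bool
  before = does (suc (suc (toℕ i)) ≟ toℕ (inject₁ i))

module _ {n} (G : Graph (Fin (suc n))) {v} (isolated : ∀ w → adj G v w ≡ false) where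

  private
    _~_ : Fin (suc n) → Fin n → Set
    x ~ x′ = punchIn v x′ ≡ x

    without : Graph (Fin n)
    without = restrict G (punchIn v)

    partner : ∀ {x y} → adj G x y ≡ true → ∃[ x′ ] x ~ x′
    partner {x} {y} xy = punchOut v≢x , Fin.punchIn-punchOut v≢x
      where
      v≢x : v ≢ x
      v≢x refl = case trans (sym xy) (isolated y) of λ ()

  edgeCount-without : edgeCount without ≡ edgeCount G
  edgeCount-without = ≤-antisym
    (edgeCount-transfer without G (λ x′ x → x ~ x′)
      (λ { {x′} {y′} refl eq → sym (Fin.punchIn-injective v y′ x′ eq) }) (λ { refl refl → refl }) (λ _ → _ , refl))
    (edgeCount-transfer G without _~_ (λ p q → trans (sym p) q) (λ { refl refl → refl }) partner)

  -- Every vertex of a copy has a neighbour within the copy, so none of them is the isolated vertex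
  -- `v`.
  copies-without : ∀ {k} {H : Graph (Fin k)} → NoIsolated H → inducedCopies G H ≤ inducedCopies without H
  copies-without {H = H} nbr = copies-transfer G without H _~_ (λ p q → trans (sym p) q) (λ { refl refl → refl })
    λ hom i → let (j , ij) = nbr i in partner (trans (hom i j) ij)

isolated? : ∀ {n} (G : Graph (Fin n)) → Dec (∃[ v ] (∀ w → adj G v w ≡ false))
isolated? G = any? (λ v → all? (λ w → adj G v w Bool.≟ false))

length-darts : ∀ {n} (G : Graph (Fin n)) → length (darts G) ≡ 2 * edgeCount G
length-darts G = trans (length-++ (edges G))
  (cong (edgeCount G +_) (trans (length-map swap (edges G)) (sym (+-identityʳ _))))

-- Every vertex is the first end of some dart, and each edge gives two darts.
order-bound : ∀ {n} (G : Graph (Fin n)) → ¬ (∃[ v ] (∀ w → adj G v w ≡ false)) → n ≤ 2 * edgeCount G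
order-bound {n} G ¬isolated = begin
  n                   ≡⟨ length-allFin n ⟨
  length (allFin n)   ≤⟨ length-≤-by-relation (λ v e → v ≡ proj₁ e) (Unique.allFin⁺ n)
                           (λ {v} _ → let (w , vw) = neighbour v in (v , w) , ∈-darts⁺ G vw , refl)
                           (λ p q → trans p (sym q)) ⟩
  length (darts G)    ≡⟨ length-darts G ⟩
  2 * edgeCount G     ∎
  where
  open ≤-Reasoning
  neighbour : ∀ v → ∃[ w ] adj G v w ≡ true
  neighbour v with any? (λ w → adj G v w Bool.≟ true)
  ... | yes p = p
  ... | no ¬p = contradiction (v , λ w → Bool.¬-not (λ vw → ¬p (w , vw))) ¬isolated

Reduced : ∀ {n k} → Graph (Fin n) → Graph (Fin k) → Set
Reduced G H = ∃[ n′ ] Σ[ G′ ∈ Graph (Fin n′) ]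
  (n′ ≤ 2 * edgeCount G × edgeCount G′ ≡ edgeCount G × inducedCopies G H ≤ inducedCopies G′ H)

discard-isolated : ∀ {n k} (G : Graph (Fin n)) {H : Graph (Fin k)} → NoIsolated H → Reduced G H
discard-isolated {n} G {H} nbr = by-cases n G (isolated? G)
  where
  by-cases : ∀ n (G : Graph (Fin n)) → Dec (∃[ v ] (∀ w → adj G v w ≡ false)) → Reduced G H
  by-cases n       G (no ¬isolated)        = n , G , order-bound G ¬isolated , refl , ≤-refl
  by-cases (suc n) G (yes (v , isolated)) =
    let G⁻ = restrict G (punchIn v)
        (n′ , G′ , n′≤ , edges≡ , copies≤) = by-cases n G⁻ (isolated? G⁻)
    in n′ , G′
     , subst (λ e → n′ ≤ 2 * e) (edgeCount-without G isolated) n′≤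
     , trans edges≡ (edgeCount-without G isolated)
     , ≤-trans (copies-without G isolated {H = H} nbr) copies≤

-- Reads any 0-1 matrix as a graph by symmetrising it and clearing the diagonal. This makes the
-- graphs on n vertices enumerable through `allSubsets`.
decode : ∀ n → Subset (n * n) → Graph (Fin n)
decode n S = record
  { adj       = λ x y → not (does (x Fin.≟ y)) ∧ (entry x y ∨ entry y x)
  ; adj-sym   = λ x y → cong₂ _∧_
      (cong not (does-⇔ (mk⇔ sym sym) (x Fin.≟ y) (y Fin.≟ x))) (Bool.∨-comm (entry x y) (entry y x))
  ; adj-irref = λ x → cong (λ b → not b ∧ (entry x x ∨ entry x x)) (dec-true (x Fin.≟ x) refl)
  }
  where
  entry : Fin n → Fin n → Bool
  entry x y = Vec.lookup S (combine x y)

encode : ∀ {n} → Graph (Fin n) → Subset (n * n)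
encode {n} G = Vec.tabulate (λ i → let (x , y) = remQuot n i in adj G x y)

-- The agreement is pointwise, not an equality of `Graph` records; counts are therefore compared by
-- transfer along `_≡_` on vertices.
decode-encode : ∀ {n} (G : Graph (Fin n)) x y → adj (decode n (encode G)) x y ≡ adj G x y
decode-encode {n} G x y = trans (cong (not (does (x Fin.≟ y)) ∧_) symmetrised) off-diagonal
  where
  entry : ∀ x y → Vec.lookup (encode G) (combine x y) ≡ adj G x y
  entry x y = trans (Vec.lookup∘tabulate _ (combine x y))
                    (cong (λ (x , y) → adj G x y) (Fin.remQuot-combine x y))

  symmetrised : Vec.lookup (encode G) (combine x y) ∨ Vec.lookup (encode G) (combine y x) ≡ adj G x y
  symmetrised = trans (cong₂ _∨_ (entry x y) (trans (entry y x) (adj-sym G y x))) (Bool.∨-idem _)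

  off-diagonal : not (does (x Fin.≟ y)) ∧ adj G x y ≡ adj G x y
  off-diagonal with x Fin.≟ y
  ... | yes refl = sym (adj-irref G x)
  ... | no  _    = refl

module _ {n} {G G′ : Graph (Fin n)} (eq : ∀ x y → adj G x y ≡ adj G′ x y) where

  edgeCount-cong-≤ : edgeCount G ≤ edgeCount G′
  edgeCount-cong-≤ = edgeCount-transfer G G′ _≡_ (λ p q → trans p (sym q)) (λ { refl refl → eq _ _ }) (λ _ → _ , refl)

  copies-cong-≤ : ∀ {k} {H : Graph (Fin k)} → inducedCopies G H ≤ inducedCopies G′ H
  copies-cong-≤ {H = H} = copies-transfer G G′ H _≡_ (λ p q → trans p (sym q)) (λ { refl refl → eq _ _ }) (λ _ _ → _ , refl)

graphsOn : (n : ℕ) → List (Σ[ n ∈ ℕ ] Graph (Fin n))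
graphsOn n = map (λ S → n , decode n S) (allSubsets (n * n))

graphsUpTo : ℕ → List (Σ[ n ∈ ℕ ] Graph (Fin n))
graphsUpTo M = concatMap graphsOn (upTo (suc M))

∈-graphsUpTo : ∀ {M n} → n ≤ M → (S : Subset (n * n)) → (n , decode n S) ∈ graphsUpTo M
∈-graphsUpTo {n = n} n≤M S =
  ∈-concatMap-intro graphsOn (∈-upTo⁺ (s≤s n≤M)) (∈-map⁺ (λ S → n , decode n S) (∈-allSubsets S))

ρ-exists : ∀ {k} {H : Graph (Fin k)} → NoIsolated H → ∀ {m} →
  ∃[ n ] Σ[ G ∈ Graph (Fin n) ] edgeCount G ≡ m → ∃ (Isρ H m)
ρ-exists {H = H} nbr {m} (n₀ , G₀ , m₀) = value best , record
  { attained   = proj₁ best , proj₂ best , best-edges , refl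
  ; upperBound = λ n G mG → bounded G mG
  }
  where
  value : Σ[ n ∈ ℕ ] Graph (Fin n) → ℕ
  value (_ , G) = inducedCopies G H

  hasSize? : (G : Σ[ n ∈ ℕ ] Graph (Fin n)) → Dec (edgeCount (proj₂ G) ≡ m)
  hasSize? (_ , G) = edgeCount G ≟ m

  candidates : List (Σ[ n ∈ ℕ ] Graph (Fin n))
  candidates = filter hasSize? (graphsUpTo (2 * m))

  best : Σ[ n ∈ ℕ ] Graph (Fin n)
  -- `G₀` is the default of `argmax`. It too has m edges, so `best` does in either case.
  best = argmax value (n₀ , G₀) candidates

  best-edges : edgeCount (proj₂ best) ≡ m
  best-edges = argmax-all value {P = λ G → edgeCount (proj₂ G) ≡ m} m₀
    (All.tabulate (λ G∈ → proj₂ (∈-filter⁻ hasSize? {xs = graphsUpTo (2 * m)} G∈)))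

  small : ∀ {n} (G : Graph (Fin n)) → n ≤ 2 * m → edgeCount G ≡ m → inducedCopies G H ≤ value best
  small {n} G n≤ mG = ≤-trans (copies-cong-≤ {G = G} {G′} (λ x y → sym (decode-encode G x y)) {H = H})
    (All.lookup (f[xs]≤f[argmax] {f = value} (n₀ , G₀) candidates)
      (∈-filter⁺ hasSize? (∈-graphsUpTo n≤ (encode G)) (trans edges≡ mG)))
    where
    G′ : Graph (Fin n)
    G′ = decode n (encode G)

    edges≡ : edgeCount G′ ≡ edgeCount G
    edges≡ = ≤-antisym (edgeCount-cong-≤ {G = G′} {G} (decode-encode G))
                       (edgeCount-cong-≤ {G = G} {G′} (λ x y → sym (decode-encode G x y)))

  bounded : ∀ {n} (G : Graph (Fin n)) → edgeCount G ≡ m → inducedCopies G H ≤ value best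
  bounded G mG =
    let (n′ , G′ , n′≤ , edges≡ , copies≤) = discard-isolated G {H} nbr
    in ≤-trans copies≤ (small G′ (subst (λ e → n′ ≤ 2 * e) mG n′≤) (trans edges≡ mG))

-- Disjoint edges

addEdge : ∀ {n} → Graph (Fin n) → Graph (Fin (2 + n))
addEdge {n} G = record { adj = e ; adj-sym = e-sym ; adj-irref = e-irref }
  where
  e : Fin (2 + n) → Fin (2 + n) → Bool
  e zero          (suc zero)    = true
  e (suc zero)    zero          = true
  e (suc (suc i)) (suc (suc j)) = adj G i j
  e _             _             = false

  e-sym : ∀ x y → e x y ≡ e y x
  e-sym zero          zero          = refl
  e-sym zero          (suc zero)    = refl
  e-sym zero          (suc (suc _)) = refl
  e-sym (suc zero)    zero          = refl
  e-sym (suc zero)    (suc zero)    = refl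
  e-sym (suc zero)    (suc (suc _)) = refl
  e-sym (suc (suc _)) zero          = refl
  e-sym (suc (suc _)) (suc zero)    = refl
  e-sym (suc (suc i)) (suc (suc j)) = adj-sym G i j

  e-irref : ∀ x → e x x ≡ false
  e-irref zero          = refl
  e-irref (suc zero)    = refl
  e-irref (suc (suc i)) = adj-irref G i

edgeCount-addEdge : ∀ {n} (G : Graph (Fin n)) → edgeCount (addEdge G) ≡ suc (edgeCount G)
edgeCount-addEdge {n} G = trans
  (≤-antisym (length-mono-⊆ (edges-unique (addEdge G)) edges⊆) (length-mono-⊆ shifted-unique ⊆edges))
  (cong suc (length-map shift (edges G)))
  where
  shift : Fin n × Fin n → Fin (2 + n) × Fin (2 + n)
  shift (i , j) = suc (suc i) , suc (suc j)

  shifted : List (Fin (2 + n) × Fin (2 + n))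
  shifted = (zero , suc zero) ∷ map shift (edges G)

  shifted-unique : Unique shifted
  shifted-unique =
      All.tabulate (λ e∈ eq → case trans eq (proj₂ (proj₂ (∈-map⁻ shift e∈))) of λ ())
    ∷ Unique.map⁺ (λ { refl → refl }) (edges-unique G)

  edges⊆ : ∀ {e} → e ∈ edges (addEdge G) → e ∈ shifted
  edges⊆ {x , y} e∈ = cases x y (∈-edges⁻ (addEdge G) e∈)
    where
    cases : ∀ x y → x Fin.< y × adj (addEdge G) x y ≡ true → (x , y) ∈ shifted
    cases zero          (suc zero)    _             = here refl
    cases (suc zero)    zero          (() , _)
    cases (suc (suc i)) (suc (suc j)) (s≤s (s≤s i<j) , ij) = there (∈-map⁺ shift (∈-edges⁺ G i<j ij))

  ⊆edges : ∀ {e} → e ∈ shifted → e ∈ edges (addEdge G)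
  ⊆edges (here refl) = ∈-edges⁺ (addEdge G) (s≤s z≤n) refl
  ⊆edges (there e∈) =
    let (_ , ij∈ , eq) = ∈-map⁻ shift e∈
        (i<j , ij)     = ∈-edges⁻ G ij∈
    in subst (_∈ edges (addEdge G)) (sym eq) (∈-edges⁺ (addEdge G) (s≤s (s≤s i<j)) ij)

copies-addEdge : ∀ {n k} (G : Graph (Fin n)) {H : Graph (Fin k)} →
  inducedCopies G H ≤ inducedCopies (addEdge G) H
copies-addEdge G {H} = copies-transfer G (addEdge G) H (λ v v′ → suc (suc v) ≡ v′)
  (λ { refl refl → refl }) (λ { refl refl → refl }) (λ _ _ → _ , refl)

-- Fills up a construction to exactly the prescribed number of edges; the old graph stays induced,
-- so its copies survive.
addEdges : ∀ {n k} d (G : Graph (Fin n)) (H : Graph (Fin k)) →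
  ∃[ n′ ] Σ[ G′ ∈ Graph (Fin n′) ] (edgeCount G′ ≡ d + edgeCount G × inducedCopies G H ≤ inducedCopies G′ H)
addEdges zero    G H = _ , G , refl , ≤-refl
addEdges (suc d) G H =
  let (n′ , G′ , edges≡ , copies≤) = addEdges d G H
  in _ , addEdge G′ , trans (edgeCount-addEdge G′) (cong suc edges≡)
   , ≤-trans copies≤ (copies-addEdge G′ {H})

-- Blow-ups of odd cycles

-- The cyclic predecessor, i - 1 modulo n + 1.
prev : ∀ {n} → Fin (suc n) → Fin (suc n)
prev zero    = Fin.fromℕ _
prev (suc i) = inject₁ i

prev-injective : ∀ {n} (i j : Fin (suc n)) → prev i ≡ prev j → i ≡ j
prev-injective zero    zero    _  = refl
prev-injective zero    (suc j) eq = contradiction eq Fin.fromℕ≢inject₁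
prev-injective (suc i) zero    eq = contradiction (sym eq) Fin.fromℕ≢inject₁
prev-injective (suc i) (suc j) eq = cong suc (Fin.inject₁-injective eq)

prev-surjective : ∀ {n} (j : Fin (suc n)) → ∃[ i ] prev i ≡ j
prev-surjective j with view j
... | ‵fromℕ     = zero , refl
... | ‵inject₁ i = suc i , refl

prev≢id : ∀ {n} (i : Fin (2 + n)) → prev i ≢ i
prev≢id zero    ()
prev≢id (suc i) eq = <⇒≢ (n<1+n (toℕ i)) (trans (sym (Fin.toℕ-inject₁ i)) (cong toℕ eq))

-- Two vertices at least, so that `prev` has no fixed point; `cycle 0` is a single edge.
cycle : ∀ n → Graph (Fin (2 + n))
cycle n = record
  { adj       = λ i j → next i j ∨ next j i
  ; adj-sym   = λ i j → Bool.∨-comm (next i j) (next j i)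
  ; adj-irref = λ i → cong (λ b → b ∨ b) (dec-false (prev i Fin.≟ i) (prev≢id i))
  }
  where
  next : Fin (2 + n) → Fin (2 + n) → Bool
  next i j = does (prev j Fin.≟ i)

cycle-prev : ∀ n i j → adj (cycle n) (prev i) (prev j) ≡ adj (cycle n) i j
cycle-prev n i j = cong₂ _∨_ (next-prev i j) (next-prev j i)
  where
  next-prev : ∀ i j → does (prev (prev j) Fin.≟ prev i) ≡ does (prev j Fin.≟ i)
  next-prev i j = does-⇔ (mk⇔ (prev-injective _ _) (cong prev)) (prev (prev j) Fin.≟ prev i) (prev j Fin.≟ i)

-- Removing the top vertex opens the cycle: the wrap-around step `prev zero` leads to the top, which
-- is no value of `inject₁`.
cycle-inject₁ : ∀ n i j → adj (cycle n) (inject₁ i) (inject₁ j) ≡ adj (path (suc n)) i j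
cycle-inject₁ n i j = cong₂ _∨_ (next-inject₁ i j) (next-inject₁ j i)
  where
  to : ∀ {m} (i j : Fin (suc m)) → prev (inject₁ j) ≡ inject₁ i → suc (toℕ i) ≡ toℕ j
  to i zero    eq = contradiction eq Fin.fromℕ≢inject₁
  to i (suc j) eq = cong suc (trans (cong toℕ (sym (Fin.inject₁-injective eq))) (Fin.toℕ-inject₁ j))

  from : ∀ {m} (i j : Fin (suc m)) → suc (toℕ i) ≡ toℕ j → prev (inject₁ j) ≡ inject₁ i
  from i (suc j) eq = cong inject₁ (Fin.toℕ-injective (trans (Fin.toℕ-inject₁ j) (sym (suc-injective eq))))

  next-inject₁ : ∀ i j → does (prev (inject₁ j) Fin.≟ inject₁ i) ≡ does (suc (toℕ i) ≟ toℕ j)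
  next-inject₁ i j = does-⇔ (mk⇔ (to i j) (from i j)) (prev (inject₁ j) Fin.≟ inject₁ i) (suc (toℕ i) ≟ toℕ j)

-- An automorphism of the cycle taking the top vertex to `p`. It carries `cycle-inject₁` over to the
-- removal of an arbitrary vertex.
record Rotation {n} (p : Fin (2 + n)) : Set where
  field
    rot        : Fin (2 + n) → Fin (2 + n)
    injective  : ∀ i j → rot i ≡ rot j → i ≡ j
    surjective : ∀ j → ∃[ i ] rot i ≡ j
    preserves  : ∀ i j → adj (cycle n) (rot i) (rot j) ≡ adj (cycle n) i j
    top        : rot (Fin.fromℕ (suc n)) ≡ p

-- Descending induction from the top vertex: composing with `prev` moves the image of the top from
-- `suc i` to `inject₁ i`.
rotation : ∀ {n} (p : Fin (2 + n)) → Rotation p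
rotation {n} = >-weakInduction Rotation base step
  where
  base : Rotation (Fin.fromℕ (suc n))
  base = record
    { rot = λ i → i ; injective = λ _ _ eq → eq ; surjective = λ j → j , refl
    ; preserves = λ _ _ → refl ; top = refl }

  step : ∀ i → Rotation (suc i) → Rotation (inject₁ i)
  step i r = record
    { rot        = prev ∘ rot
    ; injective  = λ i j eq → injective i j (prev-injective _ _ eq)
    ; surjective = λ j →
        let (i , prev-i≡j) = prev-surjective j
            (h , rot-h≡i)  = surjective i
        in h , trans (cong prev rot-h≡i) prev-i≡j
    ; preserves  = λ i j → trans (cycle-prev n (rot i) (rot j)) (preserves i j)
    ; top        = cong prev top
    }
    where open Rotation r

blowUp : ∀ {k} → Graph (Fin k) → ∀ s → Graph (Fin (k * s))
blowUp K s = restrict K (λ x → proj₁ (remQuot s x))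

blowUp-adj : ∀ {k} (K : Graph (Fin k)) s p q a b →
  adj (blowUp K s) (combine p a) (combine q b) ≡ adj K p q
blowUp-adj K s p q a b =
  cong₂ (adj K) (cong proj₁ (Fin.remQuot-combine p a)) (cong proj₁ (Fin.remQuot-combine q b))

funToFin-cong : ∀ {m n} {f g : Fin m → Fin n} → (∀ i → f i ≡ g i) → funToFin f ≡ funToFin g
funToFin-cong {zero}  eq = refl
funToFin-cong {suc m} eq = cong₂ combine (eq zero) (funToFin-cong (eq ∘ suc))

finToFun-injective : ∀ {m n} {c d : Fin (n ^ m)} →
  (∀ i → finToFun {n} {m} c i ≡ finToFun {n} {m} d i) → c ≡ d
finToFun-injective {m} {n} {c} {d} eq =
  trans (sym (Fin.funToFin-finToFin {m} {n} c)) (trans (funToFin-cong eq) (Fin.funToFin-finToFin {m} {n} d))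

module _ (n s : ℕ) where

  private
    V = Fin ((2 + n) * s)

    G : Graph V
    G = blowUp (cycle n) s

  -- Each edge joins some class `p` to the class `prev p`, and is fixed by `p` and a position in
  -- each of the two classes.
  edgeCount-blowUp-cycle : edgeCount G ≤ (2 + n) * (s * s)
  edgeCount-blowUp-cycle = begin
    edgeCount G            ≤⟨ length-≤-by-relation _joins_ (edges-unique G)
                                (λ {e} → slot {e}) (λ {e} {f} {t} → joins-unique {e} {f} {t}) ⟩
    length slots           ≡⟨ length-cartesianProduct (allFin (2 + n)) (cartesianProduct (allFin s) (allFin s)) ⟩
    length (allFin (2 + n)) * length (cartesianProduct (allFin s) (allFin s))
      ≡⟨ cong₂ _*_ (length-allFin (2 + n))
                   (trans (length-cartesianProduct (allFin s) (allFin s))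
                          (cong₂ _*_ (length-allFin s) (length-allFin s))) ⟩
    (2 + n) * (s * s)      ∎
    where
    open ≤-Reasoning
    Slot = Fin (2 + n) × Fin s × Fin s

    slots : List Slot
    slots = cartesianProduct (allFin (2 + n)) (cartesianProduct (allFin s) (allFin s))

    ∈-slots : ∀ e → e ∈ slots
    ∈-slots (p , a , b) = ∈-cartesianProduct⁺ (∈-allFin p) (∈-cartesianProduct⁺ (∈-allFin a) (∈-allFin b))

    ends : Slot → V × V
    ends (p , a , b) = combine p a , combine (prev p) b

    _joins_ : V × V → Slot → Set
    e joins t = proj₁ e Fin.< proj₂ e × (e ≡ ends t ⊎ swap e ≡ ends t)

    joins-unique : ∀ {e f t} → e joins t → f joins t → e ≡ f
    joins-unique (_   , inj₁ p) (_   , inj₁ q) = trans p (sym q)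
    joins-unique (_   , inj₂ p) (_   , inj₂ q) = cong swap (trans p (sym q))
    joins-unique (v<w , inj₁ refl) (x<y , inj₂ refl) = contradiction x<y (<-asym v<w)
    joins-unique (v<w , inj₂ refl) (x<y , inj₁ refl) = contradiction x<y (<-asym v<w)

    slot-at : ∀ {x y p q} a b → combine p a ≡ x → combine q b ≡ y →
      x Fin.< y → adj (cycle n) p q ≡ true → ∃[ t ] t ∈ slots × (x , y) joins t
    slot-at {p = p} {q} a b refl refl x<y pq with prev q Fin.≟ p | prev p Fin.≟ q
    ... | yes refl | _        = (q , b , a) , ∈-slots _ , x<y , inj₂ refl
    ... | no  _    | yes refl = (p , a , b) , ∈-slots _ , x<y , inj₁ refl

    slot : ∀ {e} → e ∈ edges G → ∃[ t ] t ∈ slots × e joins t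
    slot {x , y} e∈ =
      let (x<y , xy) = ∈-edges⁻ G e∈
          (p , a)    = remQuot s x
          (q , b)    = remQuot s y
      in slot-at {p = p} {q} a b (Fin.combine-remQuot s x) (Fin.combine-remQuot s y) x<y xy

  transversal : Fin (2 + n) → (Fin (suc n) → Fin s) → Fin (suc n) → V
  transversal p w j = combine (punchIn p j) (w j)

  -- `transversal` lists the classes other than `p` in numerical order, whereas the path runs
  -- through them in cyclic order. That order is `r`, obtained from the rotation, and `slot`
  -- translates it into the indices used by `w`.
  transversal-embedding : ∀ p w → ∃ (IsEmbedding G (image (transversal p w)) (path (suc n)))
  transversal-embedding p w = f , into , onto , inj , hom
    where
    open Rotation (rotation p)

    r : Fin (suc n) → Fin (2 + n)
    r i = rot (inject₁ i)

    p≢r : ∀ i → p ≢ r i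
    p≢r i eq = Fin.fromℕ≢inject₁ (injective _ _ (trans top eq))

    slot : Fin (suc n) → Fin (suc n)
    slot i = punchOut (p≢r i)

    f : Fin (suc n) → V
    f i = transversal p w (slot i)

    into : ∀ i → f i ∈ₛ image (transversal p w)
    into i = ∈-image⁺ (transversal p w) (slot i)

    slot-surjective : ∀ j → ∃[ i ] slot i ≡ j
    slot-surjective j with a , rot-a ← surjective (punchIn p j) with view a
    ... | ‵fromℕ     = contradiction (trans (sym rot-a) top) (Fin.punchInᵢ≢i p j)
    ... | ‵inject₁ i = i , Fin.punchIn-injective p _ _ (trans (Fin.punchIn-punchOut (p≢r i)) rot-a)

    onto : ∀ v → v ∈ₛ image (transversal p w) → ∃[ i ] f i ≡ v
    onto v v∈ =
      let (j , tj≡v) = ∈-image⁻ (transversal p w) v∈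
          (i , si≡j) = slot-surjective j
      in i , trans (cong (transversal p w) si≡j) tj≡v

    inj : ∀ i j → f i ≡ f j → i ≡ j
    inj i j eq = Fin.inject₁-injective (injective _ _ (begin
      r i                  ≡⟨ Fin.punchIn-punchOut (p≢r i) ⟨
      punchIn p (slot i)   ≡⟨ Fin.combine-injectiveˡ _ (w (slot i)) _ (w (slot j)) eq ⟩
      punchIn p (slot j)   ≡⟨ Fin.punchIn-punchOut (p≢r j) ⟩
      r j                  ∎))
      where open ≡-Reasoning

    hom : ∀ i j → adj G (f i) (f j) ≡ adj (path (suc n)) i j
    hom i j = begin
      adj G (f i) (f j)
        ≡⟨ blowUp-adj (cycle n) s (punchIn p (slot i)) (punchIn p (slot j)) (w (slot i)) (w (slot j)) ⟩
      adj (cycle n) (punchIn p (slot i)) (punchIn p (slot j))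
        ≡⟨ cong₂ (adj (cycle n)) (Fin.punchIn-punchOut (p≢r i)) (Fin.punchIn-punchOut (p≢r j)) ⟩
      adj (cycle n) (r i) (r j)
        ≡⟨ preserves (inject₁ i) (inject₁ j) ⟩
      adj (cycle n) (inject₁ i) (inject₁ j)
        ≡⟨ cycle-inject₁ n i j ⟩
      adj (path (suc n)) i j ∎
      where open ≡-Reasoning

  -- The omitted class is the only one that the set misses, and in every other class the set has
  -- exactly one vertex, which gives back `w`.
  image-transversal-injective : ∀ {p q w w′} → image (transversal p w) ≡ image (transversal q w′) →
    p ≡ q × (∀ j → w j ≡ w′ j)
  image-transversal-injective {p} {q} {w} {w′} eq with p Fin.≟ q
  ... | no p≢q =
    let j = punchOut (p≢q ∘ sym)
        (i , ti≡) = ∈-image⁻ (transversal p w)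
                      (subst (transversal q w′ j ∈ₛ_) (sym eq) (∈-image⁺ (transversal q w′) j))
    in contradiction
         (trans (Fin.combine-injectiveˡ (punchIn p i) (w i) (punchIn q j) (w′ j) ti≡) (Fin.punchIn-punchOut _))
         (Fin.punchInᵢ≢i p i)
  ... | yes refl = refl , λ j →
    let (i , ti≡)      = ∈-image⁻ (transversal p w′) (subst (transversal p w j ∈ₛ_) eq (∈-image⁺ (transversal p w) j))
        (pi≡pj , w′≡w) = Fin.combine-injective (punchIn p i) (w′ i) (punchIn p j) (w j) ti≡
    in trans (sym w′≡w) (cong w′ (Fin.punchIn-injective p i j pi≡pj))

  copies-blowUp-cycle : (2 + n) * s ^ suc n ≤ inducedCopies G (path (suc n))
  copies-blowUp-cycle = begin
    (2 + n) * s ^ suc n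
      ≡⟨ cong₂ _*_ (length-allFin (2 + n)) (length-allFin (s ^ suc n)) ⟨
    length (allFin (2 + n)) * length (allFin (s ^ suc n))
      ≡⟨ length-cartesianProduct (allFin (2 + n)) (allFin (s ^ suc n)) ⟨
    length (cartesianProduct (allFin (2 + n)) (allFin (s ^ suc n)))
      ≤⟨ length-≤-by-relation _spans_
           (Unique.cartesianProduct⁺ (Unique.allFin⁺ (2 + n)) (Unique.allFin⁺ (s ^ suc n)))
           (λ {x} _ → _ , ∈-copies⁺ G (path (suc n)) (proj₂ (transversal-embedding (proj₁ x) (choice x))) , refl)
           spans-unique ⟩
    inducedCopies G (path (suc n)) ∎
    where
    open ≤-Reasoning
    choice : Fin (2 + n) × Fin (s ^ suc n) → Fin (suc n) → Fin s
    choice (_ , c) = finToFun c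

    _spans_ : Fin (2 + n) × Fin (s ^ suc n) → Subset ((2 + n) * s) → Set
    x spans S = image (transversal (proj₁ x) (choice x)) ≡ S

    spans-unique : ∀ {x y S} → x spans S → y spans S → x ≡ y
    spans-unique {_ , c} {_ , d} p q =
      let (p≡q , w≗w′) = image-transversal-injective (trans p (sym q))
      in cong₂ _,_ p≡q (finToFun-injective {suc n} {s} w≗w′)

many-copies : ∀ {N} → 2 ≤ N → ∀ s m → suc N * (s * s) ≤ m →
  ∃[ n ] Σ[ G ∈ Graph (Fin n) ] (edgeCount G ≡ m × suc N * s ^ N ≤ inducedCopies G (path N))
many-copies {suc n} _ s m ks²≤m =
  let B = blowUp (cycle n) s
      (n′ , G , edges≡ , copies≤) = addEdges (m ∸ edgeCount B) B (path (suc n))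
  in n′ , G
   , trans edges≡ (m∸n+n≡m (≤-trans (edgeCount-blowUp-cycle n s) ks²≤m))
   , ≤-trans (copies-blowUp-cycle n s) copies≤

-- Asymptotics of the lower bound

open import Data.Integer using (+_; -[1+_]; +≤+; +<+)

-- (s + 1)ⁿ (s + 1 − n) ≤ sⁿ (s + 1), with both sides moved so that no subtraction occurs.
bernoulli : ∀ s n → suc s ^ n * suc s ≤ s ^ n * suc s + n * suc s ^ n
bernoulli s zero    = m≤m+n _ 0
bernoulli s (suc n) = begin
  suc s * q * suc s                              ≡⟨ *-assoc (suc s) q (suc s) ⟩
  suc s * (q * suc s)                            ≤⟨ *-monoʳ-≤ (suc s) (bernoulli s n) ⟩
  suc s * (p * suc s + n * q)                    ≡⟨ identity₁ s n p q ⟩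
  s * p * suc s + p * suc s + n * (suc s * q)    ≤⟨ +-monoˡ-≤ (n * (suc s * q)) (+-monoʳ-≤ (s * p * suc s)
                                                      (*-monoˡ-≤ (suc s) (^-monoˡ-≤ n (n≤1+n s)))) ⟩
  s * p * suc s + q * suc s + n * (suc s * q)    ≡⟨ identity₂ s n p q ⟩
  s * p * suc s + suc n * (suc s * q)            ∎
  where
  open ≤-Reasoning
  p = s ^ n
  q = suc s ^ n

  identity₁ : ∀ s n p q →
    suc s * (p * suc s + n * q) ≡ s * p * suc s + p * suc s + n * (suc s * q)
  identity₁ = solve-∀

  identity₂ : ∀ s n p q →
    s * p * suc s + q * suc s + n * (suc s * q) ≡ s * p * suc s + suc n * (suc s * q)
  identity₂ = solve-∀

-- The root s = ⌊√(m / (k + 1))⌋, by induction on `m`: it grows by at most one at each step.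
isqrt : ∀ k m → ∃[ s ] (suc k * (s * s) ≤ m × m < suc k * (suc s * suc s))
isqrt k zero    = 0 , ≤-reflexive (*-zeroʳ (suc k)) , s≤s z≤n
isqrt k (suc m) with s , lower , upper ← isqrt k m with suc k * (suc s * suc s) ≤? suc m
... | yes p = suc s , p , <-≤-trans (s≤s upper) (*-monoʳ-< (suc k) (*-mono-< (n<1+n (suc s)) (n<1+n (suc s))))
... | no ¬p = s , m≤n⇒m≤1+n lower , ≰⇒> ¬p

-- In fractions, m^l (1 - 2l / (s + 1)) ≤ k^l s^(2l): bound m by k (s + 1)² and apply `bernoulli`
-- with exponent 2l. If s + 1 ≤ 2l the left side is not positive; otherwise d = s + 1 - 2l is a
-- natural number.
pow-near-square : ∀ l k s m → m ≤ k * (suc s * suc s) →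
  m ^ l * suc s ≤ k ^ l * s ^ (2 * l) * suc s + 2 * l * m ^ l
pow-near-square l k s m m≤ with ≤-total (suc s) (2 * l)
... | inj₁ 1+s≤2l = ≤-trans (≤-trans (≤-reflexive (*-comm (m ^ l) (suc s))) (*-monoˡ-≤ (m ^ l) 1+s≤2l)) (m≤n+m _ _)
... | inj₂ 2l≤1+s with d , 2l+d≡1+s ← m≤n⇒∃[o]m+o≡n 2l≤1+s = begin
  m ^ l * suc s                                    ≡⟨ cong (m ^ l *_) 2l+d≡1+s ⟨
  m ^ l * (2 * l + d)                              ≡⟨ identity₁ (m ^ l) (2 * l) d ⟩
  m ^ l * d + 2 * l * m ^ l                        ≤⟨ +-monoˡ-≤ (2 * l * m ^ l) (begin
      m ^ l * d                                    ≤⟨ *-monoˡ-≤ d pow≤ ⟩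
      k ^ l * q * d                                ≡⟨ *-assoc (k ^ l) q d ⟩
      k ^ l * (q * d)                              ≤⟨ *-monoʳ-≤ (k ^ l) excess ⟩
      k ^ l * (s ^ (2 * l) * suc s)                ≡⟨ *-assoc (k ^ l) _ (suc s) ⟨
      k ^ l * s ^ (2 * l) * suc s                  ∎) ⟩
  k ^ l * s ^ (2 * l) * suc s + 2 * l * m ^ l      ∎
  where
  open ≤-Reasoning
  q = suc s ^ (2 * l)

  identity₁ : ∀ a n d → a * (n + d) ≡ a * d + n * a
  identity₁ = solve-∀

  pow≤ : m ^ l ≤ k ^ l * q
  pow≤ = begin
    m ^ l                         ≤⟨ ^-monoˡ-≤ l m≤ ⟩
    (k * (suc s * suc s)) ^ l     ≡⟨ ^-distribʳ-* l k (suc s * suc s) ⟩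
    k ^ l * (suc s * suc s) ^ l   ≡⟨ cong (λ z → k ^ l * (suc s * z) ^ l) (*-identityʳ (suc s)) ⟨
    k ^ l * (suc s ^ 2) ^ l       ≡⟨ cong (k ^ l *_) (^-*-assoc (suc s) 2 l) ⟩
    k ^ l * q                     ∎

  excess : q * d ≤ s ^ (2 * l) * suc s
  excess = +-cancelʳ-≤ (2 * l * q) _ _ (begin
    q * d + 2 * l * q                      ≡⟨ identity₁ q (2 * l) d ⟨
    q * (2 * l + d)                        ≡⟨ cong (q *_) 2l+d≡1+s ⟩
    q * suc s                              ≤⟨ bernoulli s (2 * l) ⟩
    s ^ (2 * l) * suc s + 2 * l * q        ∎)

lower-arithmetic : ∀ l k s m r → m ≤ k * (suc s * suc s) → k * s ^ (2 * l) ≤ r →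
  k * m ^ l * suc s ≤ r * k ^ l * suc s + 2 * l * (k * m ^ l)
lower-arithmetic l k s m r m≤ ≤r = begin
  k * m ^ l * suc s
    ≡⟨ *-assoc k (m ^ l) (suc s) ⟩
  k * (m ^ l * suc s)
    ≤⟨ *-monoʳ-≤ k (pow-near-square l k s m m≤) ⟩
  k * (k ^ l * s ^ (2 * l) * suc s + 2 * l * m ^ l)
    ≡⟨ identity k (k ^ l) (s ^ (2 * l)) (suc s) (2 * l) (m ^ l) ⟩
  k * s ^ (2 * l) * k ^ l * suc s + 2 * l * (k * m ^ l)
    ≤⟨ +-monoˡ-≤ (2 * l * (k * m ^ l)) (*-monoˡ-≤ (suc s) (*-monoˡ-≤ (k ^ l) ≤r)) ⟩
  r * k ^ l * suc s + 2 * l * (k * m ^ l) ∎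
  where
  open ≤-Reasoning

  identity : ∀ k p q s n x → k * (p * q * s + n * x) ≡ k * q * p * s + n * (k * x)
  identity = solve-∀

-- This is − n / (s + 1): mkℚᵘ takes the predecessor of the denominator.
defect : ℕ → ℕ → ℚᵘ
defect n s = mkℚᵘ (ℤ.- (+ n)) s

-- The hypothesis with n k x subtracted in ℤ; `left` and `right` match its two sides with the
-- cross-products in the definition of `_≤ᵘ_`.
defect-lower : ∀ n s k x r D .{{_ : NonZero D}} → k * x * suc s ≤ r * D * suc s + n * (k * x) →
  ((1ℚᵘ +ᵘ defect n s) *ᵘ (fromℕ k *ᵘ (+ x / D))) ≤ᵘ fromℕ r
defect-lower n s k x r D@(suc _) h = *≤* (ℤ.≤-trans (ℤ.≤-reflexive left)
  (ℤ.≤-trans (ℤ.+-monoˡ-≤ (ℤ.- (+ (n * (k * x)))) (+≤+ h)) (ℤ.≤-reflexive right)))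
  where
  open ≡-Reasoning
  left : ((+ 1 ℤ.* + suc s) ℤ.+ (ℤ.- (+ n)) ℤ.* + 1) ℤ.* (+ k ℤ.* + x) ℤ.* + 1
       ≡ + (k * x * suc s) ℤ.+ ℤ.- (+ (n * (k * x)))
  left = begin
    ((+ 1 ℤ.* + suc s) ℤ.+ (ℤ.- (+ n)) ℤ.* + 1) ℤ.* (+ k ℤ.* + x) ℤ.* + 1
      ≡⟨ cong (λ z → ((+ 1 ℤ.* + suc s) ℤ.+ (ℤ.- (+ n)) ℤ.* + 1) ℤ.* z ℤ.* + 1) (ℤ.pos-* k x) ⟨
    ((+ 1 ℤ.* + suc s) ℤ.+ (ℤ.- (+ n)) ℤ.* + 1) ℤ.* + (k * x) ℤ.* + 1
      ≡⟨ identity (+ suc s) (+ n) (+ (k * x)) ⟩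
    + (k * x) ℤ.* + suc s ℤ.+ ℤ.- (+ n ℤ.* + (k * x))
      ≡⟨ cong₂ (λ y z → y ℤ.+ ℤ.- z) (ℤ.pos-* (k * x) (suc s)) (ℤ.pos-* n (k * x)) ⟨
    + (k * x * suc s) ℤ.+ ℤ.- (+ (n * (k * x))) ∎
    where
    identity : ∀ a n y → ((+ 1 ℤ.* a) ℤ.+ (ℤ.- n) ℤ.* + 1) ℤ.* y ℤ.* + 1 ≡ y ℤ.* a ℤ.+ ℤ.- (n ℤ.* y)
    identity = ℤ-Solver.solve-∀

  right : + (r * D * suc s + n * (k * x)) ℤ.+ ℤ.- (+ (n * (k * x))) ≡ + r ℤ.* + (1 * suc s * (1 * D))
  right = begin
    + (r * D * suc s + n * (k * x)) ℤ.+ ℤ.- (+ (n * (k * x)))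
      ≡⟨ ℤ.+-assoc (+ (r * D * suc s)) (+ (n * (k * x))) (ℤ.- (+ (n * (k * x)))) ⟩
    + (r * D * suc s) ℤ.+ (+ (n * (k * x)) ℤ.+ ℤ.- (+ (n * (k * x))))
      ≡⟨ cong (ℤ._+_ (+ (r * D * suc s))) (ℤ.+-inverseʳ (+ (n * (k * x)))) ⟩
    + (r * D * suc s) ℤ.+ + 0
      ≡⟨ ℤ.+-identityʳ _ ⟩
    + (r * D * suc s)
      ≡⟨ cong +_ (reassociate r D (suc s)) ⟩
    + (r * (1 * suc s * (1 * D)))
      ≡⟨ ℤ.pos-* r _ ⟩
    + r ℤ.* + (1 * suc s * (1 * D)) ∎
    where
    reassociate : ∀ r d s → r * d * s ≡ r * (1 * s * (1 * d))
    reassociate = solve-∀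

defect-tendsToZero : ∀ k n → TendsToZero (λ m → defect n (proj₁ (isqrt k m)))
defect-tendsToZero k n (mkℚᵘ (+ zero)  d) (*<* (+<+ ()))
defect-tendsToZero k n (mkℚᵘ (-[1+ _ ]) d) (*<* ())
-- Here ε = (p + 1) / (d + 1). From the threshold on, the root is at least t = n (d + 1), so n /
-- (root + 1) < 1 / (d + 1) ≤ ε when cross-multiplied.
defect-tendsToZero k n (mkℚᵘ (+ suc p) d) _ = suc k * (t * t) , λ m M≤m →
  *<* (subst₂ ℤ._<_ numerator refl (+<+ (<-≤-trans (s≤s (root-large m M≤m)) (m≤m+n _ _))))
  where
  t = n * suc d

  numerator : + (n * suc d) ≡ + ℤ.∣ ℤ.- (+ n) ∣ ℤ.* + suc d
  numerator = trans (ℤ.pos-* n (suc d)) (cong (λ z → + z ℤ.* + suc d) (sym (ℤ.∣-i∣≡∣i∣ (+ n))))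

  root-large : ∀ m → suc k * (t * t) ≤ m → t ≤ proj₁ (isqrt k m)
  root-large m M≤m = let (s , _ , upper) = isqrt k m in
    ≮⇒≥ λ s<t → <⇒≱ (<-≤-trans upper (*-monoʳ-≤ (suc k) (*-mono-≤ s<t s<t))) M≤m

fromℕ≤/ : ∀ c x D .{{_ : NonZero D}} → c * D ≤ x → fromℕ c ≤ᵘ + x / D
fromℕ≤/ c x D@(suc _) h = *≤* (ℤ.≤-trans (ℤ.≤-reflexive (sym (ℤ.pos-* c D)))
  (ℤ.≤-trans (+≤+ h) (ℤ.≤-reflexive (sym (ℤ.*-identityʳ (+ x))))))

-- Assembly of the two bounds

record PathMaximum (l m s : ℕ) : Set where
  field
    value : ℕ
    isρ   : Isρ (path (2 * l)) m value
    lower : suc (2 * l) * s ^ (2 * l) ≤ value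
    upper : value * (2 * (l ∸ 1) ^ (l ∸ 1)) ≤ m ^ l

module _ {l} (2≤l : 2 ≤ l) (s m : ℕ) where

  DenseGraph : Set
  DenseGraph = ∃[ n ] Σ[ G ∈ Graph (Fin n) ]
    (edgeCount G ≡ m × suc (2 * l) * s ^ (2 * l) ≤ inducedCopies G (path (2 * l)))

  2≤2l : 2 ≤ 2 * l
  2≤2l = *-monoʳ-≤ 2 (≤-trans (s≤s z≤n) 2≤l)

  upper-attained : ∀ {r} →
    ∃[ n ] Σ[ G ∈ Graph (Fin n) ] (edgeCount G ≡ m × inducedCopies G (path (2 * l)) ≡ r) →
    r * (2 * (l ∸ 1) ^ (l ∸ 1)) ≤ m ^ l
  upper-attained (n , G , refl , refl) = copies-bound G 2≤l

  pathMaximum-from : DenseGraph → PathMaximum l m s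
  pathMaximum-from (n , G , edges≡ , copies≥) = build (ρ-exists {H = path (2 * l)} (path-NoIsolated 2≤2l) (n , G , edges≡))
    where
    build : ∃ (Isρ (path (2 * l)) m) → PathMaximum l m s
    build (r , isρ) = record
      { value = r
      ; isρ   = isρ
      ; lower = ≤-trans copies≥ (Isρ.upperBound {H = path (2 * l)} isρ n G edges≡)
      ; upper = upper-attained (Isρ.attained {H = path (2 * l)} isρ)
      }

  pathMaximum : suc (2 * l) * (s * s) ≤ m → PathMaximum l m s
  pathMaximum ks²≤m = pathMaximum-from (many-copies 2≤2l s m ks²≤m)

theorem1p4 : (l : ℕ) (2≤l : 2 ≤ l) →
    Σ[ ρ ∈ (ℕ → ℕ) ]
    ( (∀ m → 1 ≤ m → Isρ (path (2 * l)) m (ρ m))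
    × (Σ[ δ ∈ (ℕ → ℚᵘ) ]
    ( TendsToZero δ
    × (∀ m → 1 ≤ m → ((1ℚᵘ +ᵘ δ m) *ᵘ lowerMain l m) ≤ᵘ fromℕ (ρ m)) ))
    × (∀ m → 1 ≤ m → fromℕ (ρ m) ≤ᵘ upperMain l 2≤l m) )
theorem1p4 l 2≤l =
    (λ m → value (best m))
  , (λ m _ → isρ (best m))
  , ( (λ m → defect (2 * l) (root m))
    , defect-tendsToZero (2 * l) (2 * l)
    , λ m _ → defect-lower (2 * l) (root m) (2 * l + 1) (m ^ l) (value (best m)) ((2 * l + 1) ^ l)
                {{m^n≢0 (2 * l + 1) l {{>-nonZero (m≤n+m 1 (2 * l))}}}}
                (lower-arithmetic l (2 * l + 1) (root m) m (value (best m))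
                  (subst (λ k → m ≤ k * (suc (root m) * suc (root m))) 1+2l≡k (<⇒≤ (proj₂ (proj₂ (isqrt (2 * l) m)))))
                  (subst (λ k → k * root m ^ (2 * l) ≤ value (best m)) 1+2l≡k (lower (best m)))))
  , λ m _ → fromℕ≤/ (value (best m)) (m ^ l) (2 * (l ∸ 1) ^ (l ∸ 1))
              {{m*n≢0 2 _ {{_}} {{m^n≢0 (l ∸ 1) (l ∸ 1) {{>-nonZero (∸-monoˡ-≤ 1 2≤l)}}}}}} (upper (best m))
  where
  open PathMaximum

  1+2l≡k : suc (2 * l) ≡ 2 * l + 1
  1+2l≡k = +-comm 1 (2 * l)

  root : ℕ → ℕ
  root m = proj₁ (isqrt (2 * l) m)

  best : ∀ m → PathMaximum l m (root m)
  best m = pathMaximum 2≤l (root m) m (proj₁ (proj₂ (isqrt (2 * l) m)))
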